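{- Every $k$-parametric Presburger arithmetic family $\{S_{\mathbf{u}} : \mathbf{u}\in\mathbb{Z}^k\}$ counting-reduces to some $2$-parametric Presburger arithmetic family $\{F_{s,t} : (s,t)\in\mathbb{Z}^2\}$ whose defining formula has the same number of quantifier alternations as the formula defining $S_{\mathbf{u}}$.
   Context: A $k$-parametric Presburger arithmetic family is a collection $\{S_{\mathbf{u}} : \mathbf{u}\in\mathbb{Z}^k\}$ of subsets of $\mathbb{Z}^d$ defined by a fixed formula: $S_{\mathbf{u}} = \{\mathbf{x}\in\mathbb{Z}^d : Q_1y_1\cdots Q_my_m\ \Theta_{\mathbf{u}}(\mathbf{x},\mathbf{y})\}$, where $Q_i\in\{\forall,\exists\}$, the $y_i$ range over $\mathbb{Z}$, and $\Theta_{\mathbf{u}}$ is a Boolean combination of linear inequalities in $(\mathbf{x},\mathbf{y})$ with coefficients and constants in $\mathbb{Z}[\mathbf{u}]$. A $k_1$-parametric family $S_{\mathbf{u}}$ counting-reduces to a $k_2$-parametric family $S'_{\mathbf{t}}$ if there is a map $f=(f_1,\dots,f_{k_2}):\mathbb{Z}^{k_1}\to\mathbb{Z}^{k_2}$ with each $f_i\in\mathbb{Z}[\mathbf{u}]$ such that for every $\mathbf{u}\in\mathbb{Z}^{k_1}$: if $|S_{\mathbf{u}}|=\infty$ then $|S'_{f(\mathbf{u})}|=\infty$, and if $|S_{\mathbf{u}}|<\infty$ then $|S_{\mathbf{u}}|=|S'_{f(\mathbf{u})}|$. -}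

module Defs where

open import Data.Nat using (ℕ; zero; suc)
open import Data.Integer using (ℤ; _+_; _*_; -_; _≤_; 0ℤ)
open import Data.Fin using (Fin)
open import Data.Vec using (Vec; []; _∷_; lookup; map)
open import Data.List using (List; length)
open import Data.List.Relation.Unary.Unique.Propositional using (Unique)
open import Data.List.Membership.Propositional using (_∈_)
open import Data.Product using (Σ; _×_; ∃)
open import Data.Sum using (_⊎_)
open import Data.Empty using (⊥)
open import Data.Unit using (⊤)
open import Relation.Nullary using (¬_)
open import Relation.Binary.PropositionalEquality using (_≡_)
open import Function.Bundles using (_⇔_)

data Poly (k : ℕ) : Set where
  const : ℤ → Poly k
  var   : Fin k → Poly k
  _⊕_   : Poly k → Poly k → Poly k
  _⊗_   : Poly k → Poly k → Poly k
  ⊖_    : Poly k → Poly k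

evalPoly : ∀ {k} → Poly k → Vec ℤ k → ℤ
evalPoly (const c) u = c
evalPoly (var i)   u = lookup u i
evalPoly (p ⊕ q)   u = evalPoly p u + evalPoly q u
evalPoly (p ⊗ q)   u = evalPoly p u * evalPoly q u
evalPoly (⊖ p)     u = - evalPoly p u

linSum : ∀ {n} → Vec ℤ n → Vec ℤ n → ℤ
linSum []       []       = 0ℤ
linSum (c ∷ cs) (v ∷ vs) = c * v + linSum cs vs

data QF (k n : ℕ) : Set where
  ineq : Vec (Poly k) n → Poly k → QF k n
  tt′  : QF k n
  ff′  : QF k n
  _∧′_ : QF k n → QF k n → QF k n
  _∨′_ : QF k n → QF k n → QF k n
  ¬′_  : QF k n → QF k n

⟦_⟧qf : ∀ {k n} → QF k n → Vec ℤ k → Vec ℤ n → Set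
⟦ ineq cs c ⟧qf u v = linSum (map (λ p → evalPoly p u) cs) v ≤ evalPoly c u
⟦ tt′ ⟧qf u v = ⊤
⟦ ff′ ⟧qf u v = ⊥
⟦ φ ∧′ ψ ⟧qf u v = ⟦ φ ⟧qf u v × ⟦ ψ ⟧qf u v
⟦ φ ∨′ ψ ⟧qf u v = ⟦ φ ⟧qf u v ⊎ ⟦ ψ ⟧qf u v
⟦ ¬′ φ ⟧qf u v = ¬ ⟦ φ ⟧qf u v

-- Prenex formulas  Q₁y₁ ⋯ Q_m y_m Θ_u(x,y), with n free variables.
-- Each quantifier binds a new variable placed at index 0 (de Bruijn).

data Quant : Set where
  ∀q ∃q : Quant

data PForm (k : ℕ) : ℕ → Set where
  qf  : ∀ {n} → QF k n → PForm k n
  qnt : ∀ {n} → Quant → PForm k (suc n) → PForm k n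

⟦_⟧ : ∀ {k n} → PForm k n → Vec ℤ k → Vec ℤ n → Set
⟦ qf θ ⟧ u v = ⟦ θ ⟧qf u v
⟦ qnt ∀q φ ⟧ u v = (y : ℤ) → ⟦ φ ⟧ u (y ∷ v)
⟦ qnt ∃q φ ⟧ u v = Σ ℤ λ y → ⟦ φ ⟧ u (y ∷ v)

prefix : ∀ {k n} → PForm k n → List Quant
prefix (qf θ) = Data.List.[]
prefix (qnt q φ) = q Data.List.∷ prefix φ

alts : List Quant → ℕ
alts Data.List.[] = 0
alts (q Data.List.∷ Data.List.[]) = 0
alts (∀q Data.List.∷ ∀q Data.List.∷ qs) = alts (∀q Data.List.∷ qs)
alts (∃q Data.List.∷ ∃q Data.List.∷ qs) = alts (∃q Data.List.∷ qs)
alts (∀q Data.List.∷ ∃q Data.List.∷ qs) = suc (alts (∃q Data.List.∷ qs))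
alts (∃q Data.List.∷ ∀q Data.List.∷ qs) = suc (alts (∀q Data.List.∷ qs))

alternations : ∀ {k n} → PForm k n → ℕ
alternations φ = alts (prefix φ)

Family : ∀ {k d} → PForm k d → Vec ℤ k → Vec ℤ d → Set
Family φ u x = ⟦ φ ⟧ u x

HasCard : ∀ {d} → (Vec ℤ d → Set) → ℕ → Set
HasCard {d} S n = Σ (List (Vec ℤ d)) λ xs →
  length xs ≡ n × Unique xs × ((x : Vec ℤ d) → S x ⇔ (x ∈ xs))

Finite : ∀ {d} → (Vec ℤ d → Set) → Set
Finite S = ∃ λ n → HasCard S n

Infinite : ∀ {d} → (Vec ℤ d → Set) → Set
Infinite S = ¬ Finite S

CountingReducesVia : ∀ {k₁ k₂ d₁ d₂} → PForm k₁ d₁ → PForm k₂ d₂ →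
                     Vec (Poly k₁) k₂ → Set
CountingReducesVia φ ψ f =
  (u : Vec ℤ _) →
    (Infinite (Family φ u) → Infinite (Family ψ (map (λ p → evalPoly p u) f)))
    × ((n : ℕ) → HasCard (Family φ u) n →
                 HasCard (Family ψ (map (λ p → evalPoly p u) f)) n)

CountingReduces : ∀ {k₁ k₂ d₁ d₂} → PForm k₁ d₁ → PForm k₂ d₂ → Set
CountingReduces {k₁} {k₂} φ ψ = Σ (Vec (Poly k₁) k₂) λ f → CountingReducesVia φ ψ f

{-# OPTIONS --safe #-}

-- Fix u and let s be a large power of a polynomial bound for the coefficients. An Ehrenfeucht–Fraïssé game on integer
-- vectors, comparing the values of finitely many linear forms up to a threshold and the entries modulo M, shows that
-- quantifiers may be restricted to |y| ≤ s^(i+2), where i is the number of outer variables, and that S_u is finite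
-- iff it lies in the box |x_i| ≤ s^(i+1); otherwise S_u meets the shell between that box and the box |x_i| ≤ s^(i+2).
-- Once all variables are bounded, every coefficient p_j(u) can be read off as a base-B digit of the single integer
-- t = Σ p_j(u) B^j, where B is a polynomial in s: multiplying t by suitable powers of B makes the linear form of an
-- atom one balanced digit of a linear combination of the variables with coefficients in Z[s,t]. One auxiliary variable
-- per atom, the quotient by a power of B, isolates that digit; being uniquely determined, it may be bound by either
-- kind of quantifier, so no alternation is added.
module Submission where

open import Defs
open import Data.Nat as ℕ using (ℕ; zero; suc; NonZero; _^_)
import Data.Nat.Properties as ℕP
import Data.Nat.DivMod as ℕD
import Data.Nat.Tactic.RingSolver as ℕSolver
open import Data.Integer using (ℤ; +_; -[1+_]; +[1+_]; _+_; _*_; -_; _-_; _≤_; _<_; ∣_∣; 0ℤ; 1ℤ; -1ℤ; +≤+; +<+; -≤+)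
import Data.Integer.Properties as ℤP
import Data.Integer.DivMod as ℤD
open import Data.Integer.Tactic.RingSolver using (solve-∀)
open import Data.Fin using (Fin; zero; suc; _↑ˡ_; _↑ʳ_)
open import Data.List as List using (List; []; _∷_; length; deduplicate)
import Data.List.Properties as ListP
open import Data.List.Relation.Unary.Any using (here; there)
open import Data.List.Membership.Propositional using (_∈_)
import Data.List.Membership.Propositional.Properties as ∈P
open import Data.List.Relation.Binary.Subset.Propositional using (_⊆_)
import Data.List.Relation.Unary.Unique.Propositional.Properties as UniqueP
import Data.List.Relation.Unary.Unique.DecPropositional.Properties as DecUniqueP
open import Data.Vec as Vec using (Vec; []; _∷_; map; zipWith; replicate; toList; lookup; _++_; _∷ʳ_; init; last; initLast)
import Data.Vec.Properties as VecP
open import Data.Vec.Relation.Unary.All as VAll using (All; []; _∷_)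
import Data.Vec.Relation.Unary.All.Properties as VAllP
open import Data.Vec.Relation.Binary.Pointwise.Inductive as PW using (Pointwise; []; _∷_)
open import Data.Product using (Σ; _×_; _,_; ∃; proj₁; proj₂)
open import Data.Sum as Sum using (_⊎_; inj₁; inj₂; [_,_]′)
open import Data.Unit using (⊤; tt)
open import Data.Empty using (⊥; ⊥-elim)
open import Relation.Nullary using (¬_; yes; no; Dec; _×-dec_; _⊎-dec_; ¬?)
open import Relation.Binary.PropositionalEquality using (_≡_; _≢_; refl; sym; trans; cong; cong₂; subst; subst₂)
open import Function.Base using (_∘_; id)
open import Function.Bundles using (_⇔_; mk⇔; module Equivalence)
open Equivalence using (to; from)

-- Reading digits requires bounds known in advance, since an unbounded variable would let a digit
-- spill into its neighbours; hence the game must come before the packing. Roots of atoms are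
-- rational, so the game is played on the variable times a common denominator, and the answer is
-- sought in a residue class that makes it divisible again. This is how moduli enter although
-- formulas have no divisibility atoms. Each eliminated variable raises coefficients, thresholds and
-- moduli polynomially, with exponents that depend on the formula alone; so one fixed power of a
-- norm that is itself a polynomial in u serves every u. Cutting S_u down to a box makes it finite.
-- Infinitude is restored by one further coordinate, forced to be 0 over the inner box and free over
-- the shell. Whether S_u is finite is never decided: the infinite case is proved by contraposition.

private variable
  k m n J : ℕ
  A : Set
  x y a b p q z δ : ℤ

-- The game

transpose : ∀ x y a b → y - x ≡ b - a → x + (a - x) ≡ a × y + (a - x) ≡ b
transpose x y a b eq = l₁ x a , trans (l₂ x y a) (trans (cong (λ t → t + a) eq) (l₃ a b))
  where
  l₁ : ∀ x a → x + (a - x) ≡ a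
  l₁ = solve-∀
  l₂ : ∀ x y a → y + (a - x) ≡ (y - x) + a
  l₂ = solve-∀
  l₃ : ∀ a b → (b - a) + a ≡ b
  l₃ = solve-∀

-- Linear inequalities are derived by matching the difference of the two sides with that of a known
-- inequality, which leaves a ring identity for the solver.
shift-< : x < y → y - x ≡ b - a → a < b
shift-< {x} {y} {b} {a} x<y eq = let l , r = transpose x y a b eq in subst₂ _<_ l r (ℤP.+-monoˡ-< (a - x) x<y)

shift-≤ : x ≤ y → y - x ≡ b - a → a ≤ b
shift-≤ {x} {y} {b} {a} x≤y eq = let l , r = transpose x y a b eq in subst₂ _≤_ l r (ℤP.+-monoˡ-≤ (a - x) x≤y)

record Cong (K a b : ℤ) : Set where
  constructor shift-by
  field
    quot : ℤ
    eqn  : b ≡ a + K * quot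

-- Threshold equivalence: a comparison with a constant of absolute value at most `T` cannot tell the
-- two values apart (`agree-≤`).
Agree : ℤ → ℤ → ℤ → Set
Agree T a b = a ≡ b ⊎ (T < a × T < b) ⊎ (a < - T × b < - T)

agree-sym : ∀ {T} → Agree T a b → Agree T b a
agree-sym (inj₁ e) = inj₁ (sym e)
agree-sym (inj₂ (inj₁ (x , y))) = inj₂ (inj₁ (y , x))
agree-sym (inj₂ (inj₂ (x , y))) = inj₂ (inj₂ (y , x))

agree-neg : ∀ {T} → Agree T a b → Agree T (- a) (- b)
agree-neg (inj₁ e) = inj₁ (cong -_ e)
agree-neg (inj₂ (inj₁ (x , y))) = inj₂ (inj₂ (ℤP.neg-mono-< x , ℤP.neg-mono-< y))
agree-neg {a} {b} {T} (inj₂ (inj₂ (x , y))) = inj₂ (inj₁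
  ( subst (_< - a) (ℤP.neg-involutive T) (ℤP.neg-mono-< x)
  , subst (_< - b) (ℤP.neg-involutive T) (ℤP.neg-mono-< y)))

≤∣∣ : ∀ x → x ≤ + ∣ x ∣
≤∣∣ (+ n) = ℤP.≤-refl
≤∣∣ -[1+ n ] = -≤+

≤∣∣-split : ∀ w → z ≤ + ∣ w ∣ → z ≤ w ⊎ z ≤ - w
≤∣∣-split (+ n) h = inj₁ h
≤∣∣-split -[1+ n ] h = inj₂ h

-≤∣∣ : ∀ x → - x ≤ + ∣ x ∣
-≤∣∣ x = subst (λ n → - x ≤ + n) (ℤP.∣-i∣≡∣i∣ x) (≤∣∣ (- x))

module Game (T K : ℕ) where

  R : ℤ
  R = + T + + K

  0≤T : 0ℤ ≤ + T
  0≤T = +≤+ ℕ.z≤n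

  T≤R : + T ≤ R
  T≤R = +≤+ (ℕP.m≤m+n T K)

  0≤R : 0ℤ ≤ R
  0≤R = +≤+ ℕ.z≤n

  -R≤-T : - R ≤ - (+ T)
  -R≤-T = ℤP.neg-mono-≤ T≤R

  -- A position within `R` is kept. One beyond `R` is pulled back, on the same side, into the window
  -- from `T + 1` to `T + K`, which meets every residue class modulo `K`.
  data Reduct (z δ : ℤ) : Set where
    same : z ≡ δ → z ≤ R → - z ≤ R → Reduct z δ
    pos  : R < z → + T < δ → δ ≤ R → Reduct z δ
    neg  : R < - z → + T < - δ → - δ ≤ R → Reduct z δ

  reduct-nat : .{{_ : NonZero K}} → ∀ n → ∃ λ δ → Cong (+ K) δ (+ n) × Reduct (+ n) δ
  reduct-nat n with n ℕ.≤? T ℕ.+ K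
  ... | yes n≤R = + n , shift-by 0ℤ (l (+ n) (+ K)) , same refl (+≤+ n≤R) (ℤP.≤-trans ℤP.neg-≤-pos (+≤+ {0} ℕ.z≤n))
    where l : ∀ n K → n ≡ n + K * 0ℤ
          l = solve-∀
  -- The representative of `n` in the window that starts at `suc T`.
  ... | no n≰R = + (suc T ℕ.+ r ℕ.% K) , shift-by (+ (r ℕ./ K)) eq
               , pos (+<+ R<n) (+<+ (ℕ.s≤s (ℕP.m≤m+n T _)))
                   (+≤+ (subst (ℕ._≤ T ℕ.+ K) (ℕP.+-suc T _) (ℕP.+-monoʳ-≤ T (ℕD.m%n<n r K))))
    where
    R<n : T ℕ.+ K ℕ.< n
    R<n = ℕP.≰⇒> n≰R
    r : ℕ
    r = n ℕ.∸ suc T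
    sT≤n : suc T ℕ.≤ n
    sT≤n = ℕP.≤-trans (ℕ.s≤s (ℕP.m≤m+n T K)) R<n
    eqℕ : n ≡ (suc T ℕ.+ r ℕ.% K) ℕ.+ K ℕ.* (r ℕ./ K)
    eqℕ = trans (sym (ℕP.m+[n∸m]≡n sT≤n)) (trans (cong (suc T ℕ.+_) (trans (ℕD.m≡m%n+[m/n]*n r K) (cong (r ℕ.% K ℕ.+_) (ℕP.*-comm (r ℕ./ K) K))))
            (sym (ℕP.+-assoc (suc T) (r ℕ.% K) _)))
    eq : + n ≡ + (suc T ℕ.+ r ℕ.% K) + + K * + (r ℕ./ K)
    eq = trans (cong +_ eqℕ) (cong (λ e → + (suc T ℕ.+ r ℕ.% K) + e) (ℤP.pos-* K (r ℕ./ K)))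

  reduct-neg : Reduct z δ → Reduct (- z) (- δ)
  reduct-neg {z} {δ} (same e u l) = same (cong -_ e) l (subst (_≤ R) (sym (ℤP.neg-involutive z)) u)
  reduct-neg {z} {δ} (pos u l h) = neg (subst (R <_) (sym (ℤP.neg-involutive z)) u) (subst (+ T <_) (sym (ℤP.neg-involutive δ)) l) (subst (_≤ R) (sym (ℤP.neg-involutive δ)) h)
  reduct-neg (neg u l h) = pos u l h

  reduct : .{{_ : NonZero K}} → ∀ z → ∃ λ δ → Cong (+ K) δ z × Reduct z δ
  reduct (+ n) = reduct-nat n
  reduct -[1+ n ] with reduct-nat (suc n)
  ... | δ , shift-by q e , r = - δ , shift-by (- q) (trans (cong -_ e) (l δ (+ K) q)) , reduct-neg r
    where l : ∀ δ K q → - (δ + K * q) ≡ - δ + K * - q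
          l = solve-∀

  reduct-bound : Reduct z δ → δ ≤ R × - δ ≤ R
  reduct-bound (same refl u l) = u , l
  reduct-bound (pos u l h) = h , ℤP.≤-trans (ℤP.neg-mono-≤ (ℤP.<⇒≤ l)) (ℤP.≤-trans (ℤP.neg-mono-≤ 0≤T) 0≤R)
  reduct-bound {z} {δ} (neg u l h) = ℤP.≤-trans (ℤP.≤-reflexive (sym (ℤP.neg-involutive δ))) (ℤP.≤-trans (ℤP.neg-mono-≤ (ℤP.<⇒≤ l)) (ℤP.≤-trans (ℤP.neg-mono-≤ 0≤T) 0≤R)) , h

  -- Here `z` is the position relative to the nearest point and `z + p` that relative to another
  -- one. Either the second is at least `z`, and then `p` and `q` are nonnegative; or it is at most
  -- `- z`, and then `p`, hence `q`, lies below `- (R + R)`, so that adding `δ ≤ R` still leaves it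
  -- below `- R`. This case is why differences of points are compared up to `R + R`.
  move-pos : R < z → + T < δ → δ ≤ R → z ≤ + ∣ z + p ∣ → Agree (R + R) p q → Agree (+ T) (z + p) (δ + q)
  move-pos {z} {δ} {p} {q} R<z T<δ δ≤R near ag with ≤∣∣-split (z + p) near
  ... | inj₁ z≤z+p = inj₂ (inj₁ (ℤP.<-≤-trans (ℤP.≤-<-trans T≤R R<z) z≤z+p , ℤP.<-≤-trans T<δ (shift-≤ 0≤q (l δ q))))
    where
    l : ∀ δ q → q - 0ℤ ≡ (δ + q) - δ
    l = solve-∀
    l′ : ∀ z p → (z + p) - z ≡ p - 0ℤ
    l′ = solve-∀
    0≤p : 0ℤ ≤ p
    0≤p = shift-≤ z≤z+p (l′ z p)
    0≤RR : 0ℤ ≤ R + R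
    0≤RR = +≤+ ℕ.z≤n
    sgn : Agree (R + R) p q → 0ℤ ≤ q
    sgn (inj₁ e) = subst (0ℤ ≤_) e 0≤p
    sgn (inj₂ (inj₁ (_ , h))) = ℤP.≤-trans 0≤RR (ℤP.<⇒≤ h)
    sgn (inj₂ (inj₂ (h , _))) = ⊥-elim (ℤP.<-irrefl refl (ℤP.<-≤-trans (ℤP.≤-<-trans 0≤p h) (ℤP.neg-mono-≤ 0≤RR)))
    0≤q = sgn ag
  ... | inj₂ z≤-w = inj₂ (inj₂ (ℤP.<-≤-trans w<-R -R≤-T , ℤP.<-≤-trans δ+q<-R -R≤-T))
    where
    w<-R : z + p < - R
    w<-R = shift-< (ℤP.<-≤-trans R<z z≤-w) (l (z + p) R)
      where l : ∀ w R → (- w) - R ≡ (- R) - w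
            l = solve-∀
    p<-2R : p < - (R + R)
    p<-2R = shift-< (ℤP.+-mono-< R<z w<-R) (l z p R)
      where l : ∀ z p R → (z + - R) - (R + (z + p)) ≡ (- (R + R)) - p
            l = solve-∀
    far : Agree (R + R) p q → q < - (R + R)
    far (inj₁ e) = subst (_< - (R + R)) e p<-2R
    far (inj₂ (inj₁ (h , _))) = ⊥-elim (ℤP.<-irrefl refl (ℤP.<-trans h (ℤP.<-≤-trans p<-2R (ℤP.≤-trans (ℤP.neg-mono-≤ (+≤+ {0} ℕ.z≤n)) (+≤+ {0} ℕ.z≤n)))))
    far (inj₂ (inj₂ (_ , h))) = h
    δ+q<-R : δ + q < - R
    δ+q<-R = shift-< (ℤP.+-mono-≤-< δ≤R (far ag)) (l R δ q)
      where l : ∀ R δ q → (R + - (R + R)) - (δ + q) ≡ (- R) - (δ + q)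
            l = solve-∀

  move : Reduct z δ → ∣ z ∣ ℕ.≤ ∣ z + p ∣ → Agree (R + R) p q → Agree (+ T) (z + p) (δ + q)
  move {z} {.z} (same refl u l) near (inj₁ refl) = inj₁ refl
  move {z} {.z} {p} {q} (same refl u l) near (inj₂ (inj₁ (h , h′))) = inj₂ (inj₁ (above h , above h′))
    where
    above : ∀ {p} → R + R < p → + T < z + p
    above {p} h = ℤP.≤-<-trans T≤R (shift-< (ℤP.+-mono-<-≤ h l) (e p z R))
      where e : ∀ p z R → (p + R) - ((R + R) + - z) ≡ (z + p) - R
            e = solve-∀
  move {z} {.z} {p} {q} (same refl u l) near (inj₂ (inj₂ (h , h′))) = inj₂ (inj₂ (below h , below h′))
    where
    below : ∀ {p} → p < - (R + R) → z + p < - (+ T)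
    below {p} h = ℤP.<-≤-trans (shift-< (ℤP.+-mono-<-≤ h u) (e p z R)) -R≤-T
      where e : ∀ p z R → (- (R + R) + R) - (p + z) ≡ (- R) - (z + p)
            e = solve-∀
  move {z} (pos u l h) near ag = move-pos u l h (ℤP.≤-trans (≤∣∣ z) (+≤+ near)) ag
  move {z} {δ} {p} {q} (neg u l h) near ag =
    subst₂ (Agree (+ T)) (e z p) (e δ q)
      (agree-neg (move-pos {p = - p} {q = - q} u l h (ℤP.≤-trans (-≤∣∣ z) (+≤+ (subst (∣ z ∣ ℕ.≤_) abs near))) (agree-neg ag)))
    where
    e : ∀ z p → - (- z + - p) ≡ z + p
    e = solve-∀
    abs : ∣ z + p ∣ ≡ ∣ - z + - p ∣
    abs = trans (cong ∣_∣ (sym (e z p))) (ℤP.∣-i∣≡∣i∣ (- z + - p))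

nearest : ∀ {I : Set} (f : I → ℕ) (i : I) is → ∃ λ j → j ∈ i ∷ is × (∀ {k} → k ∈ i ∷ is → f j ℕ.≤ f k)
nearest f i [] = i , here refl , λ { (here refl) → ℕP.≤-refl }
nearest f i (i′ ∷ is) with nearest f i′ is
... | j , j∈ , min with f i ℕ.≤? f j
...   | yes i≤j = i , here refl , λ { (here refl) → ℕP.≤-refl ; (there k∈) → ℕP.≤-trans i≤j (min k∈) }
...   | no i≰j = j , there j∈ , λ { (here refl) → ℕP.<⇒≤ (ℕP.≰⇒> i≰j) ; (there k∈) → min k∈ }

-- The answer to Y keeps its position, up to reduction, relative to the nearest of the points - α i.
game : ∀ {I : Set} (α β : I → ℤ) (i₀ : I) (is : List I) (T K : ℕ) .{{_ : NonZero K}} →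
  let R = + T + + K in
  (∀ {i j} → i ∈ i₀ ∷ is → j ∈ i₀ ∷ is → Agree (R + R) (α j - α i) (β j - β i)) →
  (∀ {i} → i ∈ i₀ ∷ is → Cong (+ K) (α i) (β i)) →
  ∀ Y → ∃ λ Y′ → Cong (+ K) Y Y′ × (∀ {j} → j ∈ i₀ ∷ is → Agree (+ T) (Y + α j) (Y′ + β j))
        × ∃ λ i → i ∈ i₀ ∷ is × ∣ Y′ + β i ∣ ℕ.≤ T ℕ.+ K
game α β i₀ is T K pair cg Y with nearest (λ i → ∣ Y + α i ∣) i₀ is
... | i , i∈ , min with Game.reduct T K (Y + α i)
... | δ , shift-by q e , red with cg i∈
... | shift-by q′ e′ = δ - β i , shift-by (- q - q′) c , agree , i , i∈ , bound
  where
  open Game T K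
  c : δ - β i ≡ Y + + K * (- q - q′)
  c = trans (cong₂ _-_ (l₁ δ (+ K * q) _ e) e′) (l₂ Y (α i) (+ K) q q′)
    where
    l₀ : ∀ δ k → δ ≡ (δ + k) - k
    l₀ = solve-∀
    l₁ : ∀ δ k w → w ≡ δ + k → δ ≡ w - k
    l₁ δ k w e = trans (l₀ δ k) (cong (_- k) (sym e))
    l₂ : ∀ Y α K q q′ → ((Y + α) - K * q) - (α + K * q′) ≡ Y + K * (- q - q′)
    l₂ = solve-∀
  agree : ∀ {j} → j ∈ i₀ ∷ is → Agree (+ T) (Y + α j) ((δ - β i) + β j)
  agree {j} j∈ = subst₂ (Agree (+ T)) (l₁ Y (α i) (α j)) (l₂ δ (β i) (β j))
    (move red (subst (∣ Y + α i ∣ ℕ.≤_) (cong ∣_∣ (sym (l₁ Y (α i) (α j)))) (min j∈)) (pair i∈ j∈))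
    where
    l₁ : ∀ Y a b → (Y + a) + (b - a) ≡ Y + b
    l₁ = solve-∀
    l₂ : ∀ Y a b → Y + (b - a) ≡ (Y - a) + b
    l₂ = solve-∀
  bound : ∣ (δ - β i) + β i ∣ ℕ.≤ T ℕ.+ K
  bound = subst (λ w → ∣ w ∣ ℕ.≤ T ℕ.+ K) (l δ (β i)) (abs-≤ δ (reduct-bound red))
    where
    l : ∀ δ b → δ ≡ (δ - b) + b
    l = solve-∀
    abs-≤ : ∀ δ → δ ≤ R × - δ ≤ R → ∣ δ ∣ ℕ.≤ T ℕ.+ K
    abs-≤ (+ n) (+≤+ h , _) = h
    abs-≤ -[1+ n ] (_ , +≤+ h) = h

-- Linear forms, similarity of integer vectors and the elimination of one variable

linSum-scale : ∀ m (g v : Vec ℤ n) → linSum (map (m *_) g) v ≡ m * linSum g v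
linSum-scale m [] [] = sym (ℤP.*-zeroʳ m)
linSum-scale m (c ∷ g) (x ∷ v) = trans (cong (λ k → m * c * x + k) (linSum-scale m g v)) (l m c x (linSum g v))
  where l : ∀ m c x r → m * c * x + m * r ≡ m * (c * x + r)
        l = solve-∀

linSum-sub : ∀ (g h v : Vec ℤ n) → linSum (zipWith _-_ g h) v ≡ linSum g v - linSum h v
linSum-sub [] [] [] = refl
linSum-sub (c ∷ g) (d ∷ h) (x ∷ v) = trans (cong (λ k → (c - d) * x + k) (linSum-sub g h v)) (l c d x (linSum g v) (linSum h v))
  where l : ∀ c d x r r′ → (c - d) * x + (r - r′) ≡ (c * x + r) - (d * x + r′)
        l = solve-∀

linSum-zero : ∀ (v : Vec ℤ n) → linSum (replicate n 0ℤ) v ≡ 0ℤ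
linSum-zero [] = refl
linSum-zero (x ∷ v) = trans (ℤP.+-identityˡ _) (linSum-zero v)

linSum-cong : ∀ {M} (h : Vec ℤ n) {v w} → Pointwise (Cong M) v w → Cong M (linSum h v) (linSum h w)
linSum-cong {M = M} [] [] = shift-by 0ℤ (l M)
  where l : ∀ M → 0ℤ ≡ 0ℤ + M * 0ℤ
        l = solve-∀
linSum-cong {M = M} (c ∷ h) (_∷_ {x = x} {xs = v} (shift-by q e) vw) with linSum-cong h vw
... | shift-by q′ e′ = shift-by (c * q + q′) (trans (cong₂ (λ a b → c * a + b) e e′) (l c x M q (linSum h v) q′))
  where l : ∀ c x M q r q′ → c * (x + M * q) + (r + M * q′) ≡ (c * x + r) + M * (c * q + q′)
        l = solve-∀

infix 4 _⊑_

_⊑_ : Vec ℤ n → ℕ → Set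
v ⊑ B = All (λ x → ∣ x ∣ ℕ.≤ B) v

⊑-mono : ∀ {A B} {v : Vec ℤ n} → A ℕ.≤ B → v ⊑ A → v ⊑ B
⊑-mono A≤B = VAll.map (λ h → ℕP.≤-trans h A≤B)

linSum-bound : ∀ {A B} {g v : Vec ℤ n} → g ⊑ A → v ⊑ B → ∣ linSum g v ∣ ℕ.≤ n ℕ.* (A ℕ.* B)
linSum-bound [] [] = ℕ.z≤n
linSum-bound {A = A} {B} (_∷_ {x = c} {xs = g} c≤ g≤) (_∷_ {x = x} {xs = v} x≤ v≤) =
  ℕP.≤-trans (ℤP.∣i+j∣≤∣i∣+∣j∣ (c * x) (linSum g v))
    (ℕP.+-mono-≤ (subst (ℕ._≤ A ℕ.* B) (sym (ℤP.∣i*j∣≡∣i∣*∣j∣ c x)) (ℕP.*-mono-≤ c≤ x≤)) (linSum-bound g≤ v≤))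

-- What can be observed of a vector at one stage of the game: the forms up to the threshold, and the
-- entries up to the modulus.
record System (n : ℕ) : Set where
  constructor system
  field
    forms  : List (Vec ℤ n)
    thr    : ℕ
    mod    : ℕ
    {{mod≢0}} : NonZero mod

open System

Similar : System n → Vec ℤ n → Vec ℤ n → Set
Similar Γ v w = (∀ {h} → h ∈ forms Γ → Agree (+ thr Γ) (linSum h v) (linSum h w)) × Pointwise (Cong (+ mod Γ)) v w

cong-refl : ∀ {M} → Cong M x x
cong-refl {x} {M} = shift-by 0ℤ (l x M)
  where l : ∀ x M → x ≡ x + M * 0ℤ
        l = solve-∀

cong-sym : ∀ {M} → Cong M x y → Cong M y x
cong-sym {x} {M = M} (shift-by q refl) = shift-by (- q) (l x M q)
  where l : ∀ x M q → x ≡ (x + M * q) + M * - q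
        l = solve-∀

similar-refl : (Γ : System n) (v : Vec ℤ n) → Similar Γ v v
similar-refl Γ v = (λ _ → inj₁ refl) , PW.refl cong-refl

similar-sym : (Γ : System n) {v w : Vec ℤ n} → Similar Γ v w → Similar Γ w v
similar-sym Γ (f , c) = (λ h∈ → agree-sym (f h∈)) , PW.sym cong-sym c

-- The absolute value, with 1 in place of 0, so that the product over all leading coefficients is a
-- nonzero common denominator.
nz : ℤ → ℕ
nz (+ zero) = 1
nz +[1+ k ] = suc k
nz -[1+ k ] = suc k

sg : ℤ → ℤ
sg (+ _) = 1ℤ
sg -[1+ _ ] = -1ℤ

nz≢0 : ∀ {c} → NonZero (nz c)
nz≢0 {+ zero} = _
nz≢0 {+[1+ k ]} = _
nz≢0 { -[1+ k ]} = _

sg*c : ∀ c → c ≢ 0ℤ → sg c * c ≡ + nz c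
sg*c (+ zero) c≢0 = ⊥-elim (c≢0 refl)
sg*c +[1+ k ] _ = ℤP.*-identityˡ +[1+ k ]
sg*c -[1+ k ] _ = ℤP.-1*i≡-i -[1+ k ]

∣sg∣ : ∀ c → ∣ sg c ∣ ≡ 1
∣sg∣ (+ _) = refl
∣sg∣ -[1+ _ ] = refl

den : List (Vec ℤ (suc n)) → ℕ
den [] = 1
den ((c ∷ _) ∷ H) = nz c ℕ.* den H

den≢0 : (H : List (Vec ℤ (suc n))) → NonZero (den H)
den≢0 [] = _
den≢0 ((c ∷ _) ∷ H) = ℕP.m*n≢0 (nz c) (den H) {{nz≢0 {c}}} {{den≢0 H}}

-- For (c ∷ g) in the list with c ≢ 0, the root -(g · v)/c is -(e · v)/den for some e listed here.
roots : List (Vec ℤ (suc n)) → List (Vec ℤ n)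
roots [] = []
roots ((c ∷ g) ∷ H) = map (sg c * + den H *_) g ∷ List.map (map (+ nz c *_)) (roots H)

-- The factor `m` is kept in order to divide agreement back to the original form; `∣ m ∣ ≤ den H`
-- bounds the threshold lost in doing so. For `c` equal to 0 there is no root, but a nonzero
-- multiple of `g` is still listed, so the form itself is compared.
roots-complete : ∀ {H : List (Vec ℤ (suc n))} {c g} → (c ∷ g) ∈ H →
  ∃ λ m → map (m *_) g ∈ roots H × (c ≢ 0ℤ → m * c ≡ + den H) × NonZero ∣ m ∣ × ∣ m ∣ ℕ.≤ den H
roots-complete {H = (c ∷ g) ∷ H} (here refl) = μ , here refl , μc , subst NonZero (sym ∣μ∣) (den≢0 H)
  , subst (ℕ._≤ nz c ℕ.* den H) (sym ∣μ∣) (ℕP.m≤n*m (den H) (nz c) {{nz≢0 {c}}})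
  where
  μ : ℤ
  μ = sg c * + den H
  ∣μ∣ : ∣ μ ∣ ≡ den H
  ∣μ∣ = trans (ℤP.∣i*j∣≡∣i∣*∣j∣ (sg c) (+ den H)) (trans (cong (ℕ._* den H) (∣sg∣ c)) (ℕP.*-identityˡ _))
  l : ∀ s d c → s * d * c ≡ s * c * d
  l = solve-∀
  μc : c ≢ 0ℤ → μ * c ≡ + (nz c ℕ.* den H)
  μc c≢0 = trans (l (sg c) (+ den H) c) (trans (cong (_* + den H) (sg*c c c≢0)) (sym (ℤP.pos-* (nz c) (den H))))
roots-complete {H = (d ∷ _) ∷ H} {c} {g} (there h∈) with roots-complete h∈
... | m , e∈ , mc , m≢0 , m≤ = + nz d * m , there (subst (_∈ List.map (map (+ nz d *_)) (roots H)) assoc (∈P.∈-map⁺ (map (+ nz d *_)) e∈))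
  , (λ c≢0 → trans (ℤP.*-assoc (+ nz d) m c) (trans (cong (+ nz d *_) (mc c≢0)) (sym (ℤP.pos-* (nz d) (den H)))))
  , subst NonZero (sym abs) (ℕP.m*n≢0 (nz d) ∣ m ∣ {{nz≢0 {d}}} {{m≢0}})
  , subst (ℕ._≤ nz d ℕ.* den H) (sym abs) (ℕP.*-monoʳ-≤ (nz d) m≤)
  where
  abs : ∣ + nz d * m ∣ ≡ nz d ℕ.* ∣ m ∣
  abs = ℤP.∣i*j∣≡∣i∣*∣j∣ (+ nz d) m
  assoc : map (+ nz d *_) (map (m *_) g) ≡ map (+ nz d * m *_) g
  assoc = trans (sym (VecP.map-∘ _ _ g)) (VecP.map-cong (λ x → sym (ℤP.*-assoc (+ nz d) m x)) g)

agree-unscale-pos : ∀ {T D} k → suc k ℕ.≤ D → Agree (+ (T ℕ.* D)) (+[1+ k ] * x) (+[1+ k ] * y) → Agree (+ T) x y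
agree-unscale-pos {x} {y} {T} {D} k m≤D (inj₁ e) = inj₁ (ℤP.*-cancelˡ-≡ +[1+ k ] x y e)
agree-unscale-pos {x} {y} {T} {D} k m≤D (inj₂ (inj₁ (h , h′))) = inj₂ (inj₁ (up h , up h′))
  where
  up : ∀ {x} → + (T ℕ.* D) < +[1+ k ] * x → + T < x
  up h = ℤP.*-cancelˡ-<-nonNeg +[1+ k ] (ℤP.≤-<-trans
    (subst (_≤ + (T ℕ.* D)) (ℤP.pos-* (suc k) T) (+≤+ (subst (ℕ._≤ T ℕ.* D) (ℕP.*-comm T (suc k)) (ℕP.*-monoʳ-≤ T m≤D)))) h)
agree-unscale-pos {x} {y} {T} {D} k m≤D (inj₂ (inj₂ (h , h′))) = inj₂ (inj₂ (dn h , dn h′))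
  where
  dn : ∀ {x} → +[1+ k ] * x < - + (T ℕ.* D) → x < - + T
  dn h = ℤP.*-cancelˡ-<-nonNeg +[1+ k ] (ℤP.<-≤-trans h
    (subst (- + (T ℕ.* D) ≤_) (trans (cong -_ (ℤP.pos-* (suc k) T)) (ℤP.neg-distribʳ-* +[1+ k ] (+ T)))
      (ℤP.neg-mono-≤ (+≤+ (subst (ℕ._≤ T ℕ.* D) (ℕP.*-comm T (suc k)) (ℕP.*-monoʳ-≤ T m≤D))))))

agree-unscale : ∀ {T D} m → NonZero ∣ m ∣ → ∣ m ∣ ℕ.≤ D → Agree (+ (T ℕ.* D)) (m * x) (m * y) → Agree (+ T) x y
agree-unscale {x} {y} {T} {D} +[1+ k ] _ m≤D ag = agree-unscale-pos k m≤D ag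
agree-unscale {x} {y} {T} {D} -[1+ k ] _ m≤D ag =
  agree-unscale-pos k m≤D (subst₂ (Agree (+ (T ℕ.* D))) (l +[1+ k ] x) (l +[1+ k ] y) (agree-neg ag))
  where l : ∀ m x → - (- m * x) ≡ m * x
        l = solve-∀

agree-weaken : ∀ {S T} → T ≤ S → Agree S x y → Agree T x y
agree-weaken T≤S (inj₁ e) = inj₁ e
agree-weaken T≤S (inj₂ (inj₁ (h , h′))) = inj₂ (inj₁ (ℤP.≤-<-trans T≤S h , ℤP.≤-<-trans T≤S h′))
agree-weaken T≤S (inj₂ (inj₂ (h , h′))) = inj₂ (inj₂ (ℤP.<-≤-trans h (ℤP.neg-mono-≤ T≤S) , ℤP.<-≤-trans h′ (ℤP.neg-mono-≤ T≤S)))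

-- The zero form makes the list nonempty, and puts each root itself among the differences that
-- `elim` observes.
points : List (Vec ℤ (suc n)) → List (Vec ℤ n)
points {n} H = replicate n 0ℤ ∷ roots H

-- The `R` of the game with threshold `T * den H` and modulus `den H * M`. The variable is
-- multiplied by `den H`, which scales the threshold; the modulus makes the answer divisible by
-- `den H` with a quotient in the right class modulo `M`.
radius : System (suc n) → ℕ
radius (system H T M) = T ℕ.* den H ℕ.+ den H ℕ.* M

-- Exactly the hypotheses of `game`: differences of points up to twice the radius, and entries
-- modulo the modulus of the game.
elim : System (suc n) → System n
elim Γ@(system H T M) = system (List.cartesianProductWith (zipWith _-_) (points H) (points H))
  (radius Γ ℕ.+ radius Γ) (den H ℕ.* M)
  {{ℕP.m*n≢0 (den H) M {{den≢0 H}}}}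

-- The game is played on `den H * y`. The answer `Y′` is congruent to it modulo `den H * M`, hence a
-- multiple of `den H`, and the quotient answers `y`.
step : (Γ : System (suc n)) {v w : Vec ℤ n} → Similar (elim Γ) v w → ∀ y →
  ∃ λ y′ → Similar Γ (y ∷ v) (y′ ∷ w) × ∃ λ e → e ∈ points (forms Γ) × ∣ y′ ∣ ℕ.≤ ∣ linSum e w ∣ ℕ.+ radius Γ
step {n} Γ@(system H T M) {v} {w} (sim , cg) y
  with game (λ e → linSum e v) (λ e → linSum e w) (replicate n 0ℤ) (roots H) (T ℕ.* den H) (den H ℕ.* M)
         {{ℕP.m*n≢0 (den H) M {{den≢0 H}}}} pair (λ {e} _ → linSum-cong e cg) (+ den H * y)
  where
  pair : ∀ {i j} → i ∈ points H → j ∈ points H →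
    Agree (+ (radius Γ ℕ.+ radius Γ)) (linSum j v - linSum i v) (linSum j w - linSum i w)
  pair {i} {j} i∈ j∈ = subst₂ (Agree (+ (radius Γ ℕ.+ radius Γ))) (linSum-sub j i v) (linSum-sub j i w)
    (sim (∈P.∈-cartesianProductWith⁺ (zipWith _-_) j∈ i∈))
... | Y′ , shift-by q e , ag , i , i∈ , near = y′ , (agree , (shift-by q refl ∷ PW.map coarser cg)) , i , i∈ , bound
  where
  D : ℤ
  D = + den H
  y′ : ℤ
  y′ = y + + M * q
  Dy′ : Y′ ≡ D * y′
  Dy′ = trans e (trans (cong (λ k → D * y + k * q) (ℤP.pos-* (den H) M)) (l D y (+ M) q))
    where l : ∀ D y M q → D * y + D * M * q ≡ D * (y + M * q)
          l = solve-∀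
  coarser : ∀ {a b} → Cong (+ (den H ℕ.* M)) a b → Cong (+ M) a b
  coarser {a} (shift-by q e) = shift-by (D * q) (trans e (trans (cong (λ k → a + k * q) (ℤP.pos-* (den H) M)) (l D a (+ M) q)))
    where l : ∀ D a M q → a + D * M * q ≡ a + M * (D * q)
          l = solve-∀
  TD≤ : + (T ℕ.* den H) ≤ + (radius Γ ℕ.+ radius Γ)
  TD≤ = +≤+ (ℕP.≤-trans (ℕP.m≤m+n _ _) (ℕP.m≤m+n _ _))
  single : ∀ {e} → e ∈ roots H → Agree (+ (T ℕ.* den H)) (linSum e v) (linSum e w)
  single {e} e∈ = subst₂ (Agree _) (eq v) (eq w) (agree-weaken TD≤ (sim (∈P.∈-cartesianProductWith⁺ (zipWith _-_) (there e∈) (here refl))))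
    where
    l : ∀ x → x - 0ℤ ≡ x
    l = solve-∀
    eq : ∀ v → linSum (zipWith _-_ e (replicate n 0ℤ)) v ≡ linSum e v
    eq v = trans (linSum-sub e (replicate n 0ℤ) v) (trans (cong (λ k → linSum e v - k) (linSum-zero v)) (l (linSum e v)))
  agree : ∀ {h} → h ∈ H → Agree (+ T) (linSum h (y ∷ v)) (linSum h (y′ ∷ w))
  agree {c ∷ g} h∈ with roots-complete h∈
  ... | m , e∈ , mc , m≢0 , m≤ with c Data.Integer.≟ 0ℤ
  ...   | yes refl = subst₂ (Agree (+ T)) (sym (ℤP.+-identityˡ _)) (sym (ℤP.+-identityˡ _))
            (agree-unscale {T = T} {den H} m m≢0 m≤ (subst₂ (Agree _) (linSum-scale m g v) (linSum-scale m g w) (single e∈)))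
  -- As `m * c` is `den H`, `m` times the form is the position of `den H * y` relative to a root,
  -- which the game has compared.
  ...   | no c≢0 = agree-unscale {T = T} {den H} m m≢0 m≤ (subst₂ (Agree _) (eq (D * y) y v refl) (eq Y′ y′ w Dy′) (ag (there e∈)))
    where
    eq : ∀ Y y v → Y ≡ D * y → Y + linSum (map (m *_) g) v ≡ m * (c * y + linSum g v)
    eq Y y v e = trans (cong₂ _+_ (trans e (cong (_* y) (sym (mc c≢0)))) (linSum-scale m g v)) (l m c y (linSum g v))
      where l : ∀ m c y r → m * c * y + m * r ≡ m * (c * y + r)
            l = solve-∀
  bound : ∣ y′ ∣ ℕ.≤ ∣ linSum i w ∣ ℕ.+ radius Γ
  bound = ℕP.≤-trans (subst (∣ y′ ∣ ℕ.≤_) (sym (ℤP.∣i*j∣≡∣i∣*∣j∣ D y′)) (ℕP.m≤n*m ∣ y′ ∣ (den H) {{den≢0 H}}))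
    (subst (λ Y → ∣ Y ∣ ℕ.≤ ∣ linSum i w ∣ ℕ.+ radius Γ) Dy′
      (subst (ℕ._≤ ∣ linSum i w ∣ ℕ.+ radius Γ) (cong ∣_∣ (l Y′ (linSum i w)))
        (ℕP.≤-trans (ℤP.∣i-j∣≤∣i∣+∣j∣ (Y′ + linSum i w) (linSum i w))
          (subst (∣ Y′ + linSum i w ∣ ℕ.+ ∣ linSum i w ∣ ℕ.≤_) (ℕP.+-comm (radius Γ) ∣ linSum i w ∣)
            (ℕP.+-monoˡ-≤ ∣ linSum i w ∣ near)))))
    where l : ∀ Y r → (Y + r) - r ≡ Y
          l = solve-∀

module _ {T B : ℕ} where

  slope-above : ∀ k {a x} → ∣ x ∣ ℕ.≤ B → T ℕ.+ B ℕ.< a → + T < +[1+ k ] * + a + x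
  slope-above k {a} {x} x≤B big = shift-< (ℤP.+-mono-<-≤ (+<+ (ℕP.<-≤-trans big (ℕP.m≤n*m a (suc k)))) (ℤP.≤-trans (-≤∣∣ x) (+≤+ x≤B)))
    (trans (cong (λ e → (e + + B) - (+ (T ℕ.+ B) + - x)) (ℤP.pos-* (suc k) a)) (l +[1+ k ] (+ a) x (+ B) (+ T)))
    where l : ∀ c a x B T → (c * a + B) - ((T + B) + - x) ≡ (c * a + x) - T
          l = solve-∀

  slope-agree-pos : ∀ c {a a′ x} → c ≢ 0ℤ → ∣ x ∣ ℕ.≤ B → T ℕ.+ B ℕ.< a → T ℕ.+ B ℕ.< a′ →
    Agree (+ T) (c * + a + x) (c * + a′ + x)
  slope-agree-pos (+ zero) c≢0 = ⊥-elim (c≢0 refl)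
  slope-agree-pos +[1+ k ] _ x≤B h h′ = inj₂ (inj₁ (slope-above k x≤B h , slope-above k x≤B h′))
  slope-agree-pos -[1+ k ] {a} {a′} {x} _ x≤B h h′ =
    subst₂ (Agree (+ T)) (l +[1+ k ] (+ a) x) (l +[1+ k ] (+ a′) x)
      (agree-neg (inj₂ (inj₁ (slope-above k {x = - x} -x≤B h , slope-above k {x = - x} -x≤B h′))))
    where
    -x≤B : ∣ - x ∣ ℕ.≤ B
    -x≤B = subst (ℕ._≤ B) (sym (ℤP.∣-i∣≡∣i∣ x)) x≤B
    l : ∀ c a x → - (c * a + - x) ≡ - c * a + x
    l = solve-∀

  slope-agree-neg : ∀ c {a a′ x} → c ≢ 0ℤ → ∣ x ∣ ℕ.≤ B → T ℕ.+ B ℕ.< a → T ℕ.+ B ℕ.< a′ →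
    Agree (+ T) (c * - + a + x) (c * - + a′ + x)
  slope-agree-neg c {a} {a′} {x} c≢0 x≤B h h′ =
    subst₂ (Agree (+ T)) (l c (+ a) x) (l c (+ a′) x) (agree-neg (slope-agree-pos c {x = - x} c≢0 (subst (ℕ._≤ B) (sym (ℤP.∣-i∣≡∣i∣ x)) x≤B) h h′))
    where l : ∀ c a x → - (c * a + - x) ≡ c * - a + x
          l = solve-∀

congruent-above : ∀ M {{_ : NonZero M}} X z → ∃ λ a → Cong (+ M) z (+ a) × X ℕ.< a × a ℕ.≤ X ℕ.+ M
congruent-above M X z = suc X ℕ.+ r , cg , ℕ.s≤s (ℕP.m≤m+n X r) , subst (ℕ._≤ X ℕ.+ M) (ℕP.+-suc X r) (ℕP.+-monoʳ-≤ X (ℤD.n%ℕd<d d M))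
  where
  d : ℤ
  d = z - + suc X
  r : ℕ
  r = d ℤD.%ℕ M
  quo : ℤ
  quo = d ℤD./ℕ M
  l₁ : ∀ z X r qM → z - X ≡ r + qM → (X + r) ≡ z - qM
  l₁ z X r qM e = trans (l₀ X r qM) (trans (cong (λ k → X + k - qM) (sym e)) (l₂ z X qM))
    where
    l₀ : ∀ X r k → X + r ≡ X + (r + k) - k
    l₀ = solve-∀
    l₂ : ∀ z X k → X + (z - X) - k ≡ z - k
    l₂ = solve-∀
  l : ∀ z q M → z - q * M ≡ z + M * - q
  l = solve-∀
  cg : Cong (+ M) z (+ (suc X ℕ.+ r))
  cg = shift-by (- quo) (trans (l₁ z (+ suc X) (+ r) (quo * + M) (ℤD.a≡a%ℕn+[a/ℕn]*n d M)) (l z quo (+ M)))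

-- Past all roots, the value of the first variable may be moved freely within its residue class.
far : (Γ : System (suc n)) {v : Vec ℤ n} {A B : ℕ} → (∀ {h} → h ∈ forms Γ → h ⊑ A) → v ⊑ B →
  ∀ {y X} → thr Γ ℕ.+ n ℕ.* (A ℕ.* B) ℕ.< ∣ y ∣ → thr Γ ℕ.+ n ℕ.* (A ℕ.* B) ℕ.≤ X →
  ∃ λ y′ → Similar Γ (y ∷ v) (y′ ∷ v) × X ℕ.< ∣ y′ ∣ × ∣ y′ ∣ ℕ.≤ X ℕ.+ mod Γ
far {n} Γ {v} {A} {B} bd v≤ {+ a} {X} big X≥ with congruent-above (mod Γ) X (+ a)
... | a′ , cg , lo , hi = + a′ , (agree , (cg ∷ PW.refl cong-refl)) , lo , hi
  where
  agree : ∀ {h} → h ∈ forms Γ → Agree (+ thr Γ) (linSum h (+ a ∷ v)) (linSum h (+ a′ ∷ v))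
  agree {c ∷ g} h∈ with c Data.Integer.≟ 0ℤ
  ... | yes refl = inj₁ refl
  ... | no c≢0 = slope-agree-pos c c≢0 (linSum-bound (VAll.tail (bd h∈)) v≤) big (ℕP.≤-<-trans X≥ lo)
far {n} Γ {v} {A} {B} bd v≤ { -[1+ a ]} {X} big X≥ with congruent-above (mod Γ) X (+ suc a)
... | a′ , shift-by q e , lo , hi = - + a′ , (agree , (shift-by (- q) (trans (cong -_ e) (l (+ suc a) (+ mod Γ) q)) ∷ PW.refl cong-refl))
    , subst (X ℕ.<_) (sym (ℤP.∣-i∣≡∣i∣ (+ a′))) lo , subst (ℕ._≤ X ℕ.+ mod Γ) (sym (ℤP.∣-i∣≡∣i∣ (+ a′))) hi
  where
  l : ∀ a M q → - (a + M * q) ≡ - a + M * - q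
  l = solve-∀
  agree : ∀ {h} → h ∈ forms Γ → Agree (+ thr Γ) (linSum h (-[1+ a ] ∷ v)) (linSum h (- + a′ ∷ v))
  agree {c ∷ g} h∈ with c Data.Integer.≟ 0ℤ
  ... | yes refl = inj₁ refl
  ... | no c≢0 = slope-agree-neg c c≢0 (linSum-bound (VAll.tail (bd h∈)) v≤) big (ℕP.≤-<-trans X≥ lo)

-- The estimates of `step` and `far` with all constants absorbed in one factor `s`: an answer can be
-- found within `s * B`, and a value beyond `s * B` can be moved to any shell from `X` to `s * X`.
record Step (s : ℕ) (Γ : System (suc n)) : Set where
  field
    near : ∀ {v w B} → 1 ℕ.≤ B → w ⊑ B → Similar (elim Γ) v w → ∀ y →
      ∃ λ y′ → Similar Γ (y ∷ v) (y′ ∷ w) × ∣ y′ ∣ ℕ.≤ s ℕ.* B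
    away : ∀ {v y B X} → 1 ℕ.≤ B → v ⊑ B → s ℕ.* B ℕ.< ∣ y ∣ → s ℕ.* B ℕ.≤ X →
      ∃ λ y′ → Similar Γ (y ∷ v) (y′ ∷ v) × X ℕ.< ∣ y′ ∣ × ∣ y′ ∣ ℕ.≤ s ℕ.* X
    1≤s : 1 ℕ.≤ s

Good : ℕ → ∀ {n} → System n → Set
Good s {zero} Γ = ⊤
Good s {suc n} Γ = Step s Γ × Good s (elim Γ)

-- Growth of coefficients, thresholds and moduli under elimination

scale-⊑ : ∀ {A C} {g : Vec ℤ n} m → ∣ m ∣ ℕ.≤ C → g ⊑ A → map (m *_) g ⊑ C ℕ.* A
scale-⊑ {A = A} {C} m m≤ g≤ = VAllP.map⁺ (VAll.map (λ {x} x≤ → subst (λ k → k ℕ.≤ C ℕ.* A) (sym (ℤP.∣i*j∣≡∣i∣*∣j∣ m x)) (ℕP.*-mono-≤ m≤ x≤)) g≤)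

length-roots : (H : List (Vec ℤ (suc n))) → length (roots H) ≡ length H
length-roots [] = refl
length-roots ((c ∷ g) ∷ H) = cong suc (trans (ListP.length-map (map (+ nz c *_)) (roots H)) (length-roots H))

nz-bound : ∀ {B} c → 1 ℕ.≤ B → ∣ c ∣ ℕ.≤ B → nz c ℕ.≤ B
nz-bound (+ zero) 1≤B _ = 1≤B
nz-bound +[1+ k ] _ h = h
nz-bound -[1+ k ] _ h = h

module _ {B : ℕ} (1≤B : 1 ℕ.≤ B) where

  den-bound : (H : List (Vec ℤ (suc n))) → (∀ {h} → h ∈ H → h ⊑ B) → den H ℕ.≤ B ^ length H
  den-bound [] small = ℕP.≤-refl
  den-bound ((c ∷ g) ∷ H) small =
    ℕP.*-mono-≤ (nz-bound c 1≤B (VAll.head (small (here refl)))) (den-bound H (λ h∈ → small (there h∈)))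

  -- Each entry of a root is, up to sign, a product with one factor from every form of the list,
  -- whence the exponent.
  roots-bound : (H : List (Vec ℤ (suc n))) → (∀ {h} → h ∈ H → h ⊑ B) → ∀ {e} → e ∈ roots H → e ⊑ (B ^ length H)
  roots-bound ((c ∷ g) ∷ H) small (here refl) = ⊑-mono (ℕP.≤-reflexive (ℕP.*-comm (B ^ length H) B))
    (scale-⊑ (sg c * + den H)
      (subst (ℕ._≤ B ^ length H) (sym (trans (ℤP.∣i*j∣≡∣i∣*∣j∣ (sg c) (+ den H)) (trans (cong (ℕ._* den H) (∣sg∣ c)) (ℕP.*-identityˡ _))))
        (den-bound H (λ h∈ → small (there h∈))))
      (VAll.tail (small (here refl))))
  roots-bound ((c ∷ g) ∷ H) small (there e∈) with ∈P.∈-map⁻ (map (+ nz c *_)) e∈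
  ... | e′ , e′∈ , refl = scale-⊑ (+ nz c) (nz-bound c 1≤B (VAll.head (small (here refl)))) (roots-bound H (λ h∈ → small (there h∈)) e′∈)

length-cartesian : ∀ {A B C : Set} (f : A → B → C) xs ys → length (List.cartesianProductWith f xs ys) ≡ length xs ℕ.* length ys
length-cartesian f [] ys = refl
length-cartesian f (x ∷ xs) ys = trans (ListP.length-++ (List.map (f x) ys)) (cong₂ ℕ._+_ (ListP.length-map (f x) ys) (length-cartesian f xs ys))

zipWith-⊑ : ∀ {A B} {g h : Vec ℤ n} → g ⊑ A → h ⊑ B → zipWith _-_ g h ⊑ (A ℕ.+ B)
zipWith-⊑ [] [] = []
zipWith-⊑ (_∷_ {x = x} x≤ g≤) (_∷_ {x = y} y≤ h≤) = ℕP.≤-trans (ℤP.∣i-j∣≤∣i∣+∣j∣ x y) (ℕP.+-mono-≤ x≤ y≤) ∷ zipWith-⊑ g≤ h≤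

zero-⊑ : ∀ {B} n → replicate n 0ℤ ⊑ B
zero-⊑ zero = []
zero-⊑ (suc n) = ℕ.z≤n ∷ zero-⊑ n

elimLen : ℕ → ℕ
elimLen l = suc l ℕ.* suc l

-- With everything bounded by `N ^ e`, the denominator is at most `N ^ (e * l)` and both summands of
-- `radius` at most `N ^ (e * l + e)`. The two successors pay, through `2 ≤ N`, for their sum and
-- for doubling the radius.
elimExp : ℕ → ℕ → ℕ
elimExp l e = suc (suc (e ℕ.* l ℕ.+ e))

-- An exponent that serves at every level at once, a sum being a convenient bound for the maximum.
-- The summand `n` absorbs the number of terms of a form, as `n ≤ N ^ n`. No value of the parameters
-- enters.
need : ℕ → ℕ → ℕ → ℕ
need zero l e = 0
need (suc n) l e = (n ℕ.+ elimExp l e) ℕ.+ need n (elimLen l) (elimExp l e)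

module Sizes (N : ℕ) (2≤N : 2 ℕ.≤ N) where

  instance
    N≢0 : NonZero N
    N≢0 = ℕ.>-nonZero (ℕP.≤-trans (ℕ.s≤s ℕ.z≤n) 2≤N)

  record Sized (l e : ℕ) (Γ : System n) : Set where
    field
      few   : length (forms Γ) ℕ.≤ l
      small : ∀ {h} → h ∈ forms Γ → h ⊑ (N ^ e)
      thr≤  : thr Γ ℕ.≤ N ^ e
      mod≤  : mod Γ ℕ.≤ N ^ e

  pow-≤ : ∀ {a b} → a ℕ.≤ b → N ^ a ℕ.≤ N ^ b
  pow-≤ = ℕP.^-monoʳ-≤ N

  1≤pow : ∀ e → 1 ℕ.≤ N ^ e
  1≤pow e = ℕP.m^n>0 N e

  double : ∀ {a b k} → a ℕ.≤ k → b ℕ.≤ k → a ℕ.+ b ℕ.≤ N ℕ.* k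
  double {k = k} a≤ b≤ = ℕP.≤-trans (ℕP.+-mono-≤ a≤ b≤) (ℕP.≤-trans (ℕP.≤-reflexive (cong (k ℕ.+_) (sym (ℕP.+-identityʳ k)))) (ℕP.*-monoˡ-≤ k 2≤N))

  n≤pow : ∀ n → n ℕ.≤ N ^ n
  n≤pow zero = ℕ.z≤n
  n≤pow (suc n) = double (1≤pow n) (n≤pow n)

  mul-pow : ∀ {a b} x y → a ℕ.≤ N ^ x → b ℕ.≤ N ^ y → a ℕ.* b ℕ.≤ N ^ (x ℕ.+ y)
  mul-pow x y a≤ b≤ = ℕP.≤-trans (ℕP.*-mono-≤ a≤ b≤) (ℕP.≤-reflexive (sym (ℕP.^-distribˡ-+-* N x y)))

  module _ {l e : ℕ} {Γ : System (suc n)} (sz : Sized l e Γ) where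
    open Sized sz

    private
      H : List (Vec ℤ (suc n))
      H = forms Γ

      len≤ : (N ^ e) ^ length H ℕ.≤ N ^ (e ℕ.* l)
      len≤ = ℕP.≤-trans (ℕP.^-monoʳ-≤ (N ^ e) {{ℕ.>-nonZero (1≤pow e)}} few) (ℕP.≤-reflexive (ℕP.^-*-assoc N e l))

      den≤ : den H ℕ.≤ N ^ (e ℕ.* l)
      den≤ = ℕP.≤-trans (den-bound (1≤pow e) H small) len≤

      points≤ : ∀ {h} → h ∈ points H → h ⊑ (N ^ (e ℕ.* l))
      points≤ (here refl) = zero-⊑ n
      points≤ (there e∈) = ⊑-mono len≤ (roots-bound (1≤pow e) H small e∈)

      radius≤ : radius Γ ℕ.≤ N ^ suc (e ℕ.* l ℕ.+ e)
      radius≤ = double (ℕP.≤-trans (mul-pow e (e ℕ.* l) thr≤ den≤) (pow-≤ (ℕP.≤-reflexive (ℕP.+-comm e (e ℕ.* l)))))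
                       (mul-pow (e ℕ.* l) e den≤ mod≤)

    elim-sized : Sized (elimLen l) (elimExp l e) (elim Γ)
    elim-sized = record
      { few = ℕP.≤-trans (ℕP.≤-reflexive (length-cartesian (zipWith _-_) (points H) (points H))) (ℕP.*-mono-≤ lp lp)
      ; small = λ h∈ → small′ (∈P.∈-cartesianProductWith⁻ (zipWith _-_) (points H) (points H) h∈)
      ; thr≤ = double radius≤ radius≤
      ; mod≤ = ℕP.≤-trans (mul-pow (e ℕ.* l) e den≤ mod≤) (pow-≤ (ℕP.m≤n+m (e ℕ.* l ℕ.+ e) 2))
      }
      where
      lp : length (points H) ℕ.≤ suc l
      lp = ℕ.s≤s (ℕP.≤-trans (ℕP.≤-reflexive (length-roots H)) few)
      small′ : ∀ {h} → (∃ λ i → ∃ λ j → i ∈ points H × j ∈ points H × h ≡ zipWith _-_ i j) → h ⊑ (N ^ elimExp l e)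
      small′ (i , j , i∈ , j∈ , refl) = ⊑-mono (ℕP.≤-trans (double {k = N ^ (e ℕ.* l)} ℕP.≤-refl ℕP.≤-refl)
          (pow-≤ (ℕP.≤-trans (ℕ.s≤s (ℕP.m≤m+n (e ℕ.* l) e)) (ℕP.n≤1+n _))))
        (zipWith-⊑ (points≤ i∈) (points≤ j∈))

    sized-step : ∀ {s} → N ^ (n ℕ.+ elimExp l e) ℕ.≤ s → Step s Γ
    sized-step {s} s≥ = record { near = near′ ; away = away′ ; 1≤s = ℕP.≤-trans (1≤pow (n ℕ.+ elimExp l e)) s≥ }
      where
      mid : ℕ
      mid = n ℕ.+ suc (e ℕ.* l ℕ.+ e)
      top : ∀ {a b B} → a ℕ.≤ N ^ mid ℕ.* B → b ℕ.≤ N ^ mid ℕ.* B → a ℕ.+ b ℕ.≤ s ℕ.* B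
      top {B = B} a≤ b≤ = ℕP.≤-trans (double a≤ b≤) (ℕP.≤-trans (ℕP.≤-reflexive (sym (ℕP.*-assoc N (N ^ mid) B)))
        (ℕP.*-monoˡ-≤ B (ℕP.≤-trans (ℕP.≤-reflexive (cong (N ^_) (sym (ℕP.+-suc n _)))) s≥)))
      term : ∀ {x y B} → y ℕ.≤ suc (e ℕ.* l ℕ.+ e) → x ℕ.≤ N ^ y → n ℕ.* (x ℕ.* B) ℕ.≤ N ^ mid ℕ.* B
      term {x} {y} {B} y≤ x≤ = ℕP.≤-trans (ℕP.≤-reflexive (sym (ℕP.*-assoc n x B)))
        (ℕP.*-monoˡ-≤ B (ℕP.≤-trans (mul-pow n y (n≤pow n) x≤) (pow-≤ (ℕP.+-monoʳ-≤ n y≤))))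
      constant : ∀ {x B} → 1 ℕ.≤ B → x ℕ.≤ N ^ suc (e ℕ.* l ℕ.+ e) → x ℕ.≤ N ^ mid ℕ.* B
      constant {B = B} 1≤B x≤ = ℕP.≤-trans x≤ (ℕP.≤-trans (pow-≤ (ℕP.m≤n+m _ n)) (ℕP.m≤m*n (N ^ mid) B {{ℕ.>-nonZero 1≤B}}))
      e≤ : e ℕ.≤ suc (e ℕ.* l ℕ.+ e)
      e≤ = ℕP.≤-trans (ℕP.m≤n+m e (e ℕ.* l)) (ℕP.n≤1+n _)
      el≤ : e ℕ.* l ℕ.≤ suc (e ℕ.* l ℕ.+ e)
      el≤ = ℕP.≤-trans (ℕP.m≤m+n (e ℕ.* l) e) (ℕP.n≤1+n _)
      near′ : ∀ {v w B} → 1 ℕ.≤ B → w ⊑ B → Similar (elim Γ) v w → ∀ y →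
        ∃ λ y′ → Similar Γ (y ∷ v) (y′ ∷ w) × ∣ y′ ∣ ℕ.≤ s ℕ.* B
      near′ {B = B} 1≤B w≤ sim y = let y′ , sim′ , i , i∈ , y′≤ = step Γ sim y in y′ , sim′ , ℕP.≤-trans y′≤
        (top (ℕP.≤-trans (linSum-bound (points≤ i∈) w≤) (term {y = e ℕ.* l} el≤ ℕP.≤-refl)) (constant 1≤B radius≤))
      away′ : ∀ {v y B X} → 1 ℕ.≤ B → v ⊑ B → s ℕ.* B ℕ.< ∣ y ∣ → s ℕ.* B ℕ.≤ X →
        ∃ λ y′ → Similar Γ (y ∷ v) (y′ ∷ v) × X ℕ.< ∣ y′ ∣ × ∣ y′ ∣ ℕ.≤ s ℕ.* X
      away′ {B = B} {X} 1≤B v≤ big X≥ with far Γ small v≤ (ℕP.≤-<-trans lim big) (ℕP.≤-trans lim X≥)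
        where
        lim : thr Γ ℕ.+ n ℕ.* (N ^ e ℕ.* B) ℕ.≤ s ℕ.* B
        lim = top (constant 1≤B (ℕP.≤-trans thr≤ (pow-≤ e≤))) (term {y = e} e≤ ℕP.≤-refl)
      ... | y′ , sim , lo , hi = y′ , sim , lo , ℕP.≤-trans hi
          (ℕP.≤-trans (ℕP.+-monoʳ-≤ X (ℕP.m≤m*n (mod Γ) X {{ℕ.>-nonZero 1≤X}})) (ℕP.*-monoˡ-≤ X 1+M≤s))
        where
        1≤s : 1 ℕ.≤ s
        1≤s = ℕP.≤-trans (1≤pow (n ℕ.+ elimExp l e)) s≥
        1≤X : 1 ℕ.≤ X
        1≤X = ℕP.≤-trans (ℕP.*-mono-≤ 1≤s 1≤B) X≥
        1+M≤s : suc (mod Γ) ℕ.≤ s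
        1+M≤s = ℕP.≤-trans (double (1≤pow e) mod≤) (ℕP.≤-trans (pow-≤ (ℕP.≤-trans (ℕ.s≤s e≤) (ℕP.m≤n+m _ n))) s≥)

  sized-good : ∀ {n l e s} {Γ : System n} → Sized l e Γ → N ^ need n l e ℕ.≤ s → Good s Γ
  sized-good {zero} sz s≥ = tt
  sized-good {suc n} {l} {e} sz s≥ =
    sized-step sz (ℕP.≤-trans (pow-≤ (ℕP.m≤m+n (n ℕ.+ elimExp l e) _)) s≥) ,
    sized-good (elim-sized sz) (ℕP.≤-trans (pow-≤ (ℕP.m≤n+m (need n (elimLen l) (elimExp l e)) (n ℕ.+ elimExp l e))) s≥)

-- Boxes with geometrically growing sides

Box : ℕ → ℕ → Vec ℤ n → Set
Box s g [] = ⊤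
Box s g (_∷_ {n} y v) = ∣ y ∣ ℕ.≤ s ^ n ℕ.* g × Box s g v

box? : ∀ s g (v : Vec ℤ n) → Dec (Box s g v)
box? s g [] = yes tt
box? s g (_∷_ {n} y v) = (∣ y ∣ ℕ.≤? s ^ n ℕ.* g) ×-dec box? s g v

box-mono : ∀ {s g g′} (v : Vec ℤ n) → g ℕ.≤ g′ → Box s g v → Box s g′ v
box-mono [] g≤ _ = tt
box-mono {s = s} (_∷_ {n} y v) g≤ (y≤ , bv) = ℕP.≤-trans y≤ (ℕP.*-monoʳ-≤ (s ^ n) g≤) , box-mono v g≤ bv

-- This is the bound that `Step.near` asks of the outer variables; its answer, within
-- `s * (s ^ n * g)`, then fits the side of the next variable in the same box.
box-⊑ : ∀ {s g} → 1 ℕ.≤ s → (v : Vec ℤ n) → Box s (s ℕ.* g) v → v ⊑ (s ^ n ℕ.* g)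
box-⊑ 1≤s [] _ = []
box-⊑ {s = s} {g} 1≤s (_∷_ {n} y v) (y≤ , bv) =
  ℕP.≤-trans y≤ (ℕP.≤-reflexive (trans (sym (ℕP.*-assoc (s ^ n) s g)) (cong (ℕ._* g) (ℕP.*-comm (s ^ n) s))))
  ∷ ⊑-mono (ℕP.*-monoˡ-≤ g (ℕP.m≤n*m (s ^ n) s {{ℕ.>-nonZero 1≤s}})) (box-⊑ 1≤s v bv)

1≤^ : ∀ {s} n → 1 ℕ.≤ s → 1 ℕ.≤ s ^ n
1≤^ {s} n 1≤s = ℕP.m^n>0 s {{ℕ.>-nonZero 1≤s}} n

swap-mult : ∀ a b c → a ℕ.* (b ℕ.* c) ≡ b ℕ.* (a ℕ.* c)
swap-mult a b c = trans (sym (ℕP.*-assoc a b c)) (trans (cong (ℕ._* c) (ℕP.*-comm a b)) (ℕP.*-assoc b a c))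

-- Only the outermost coordinate leaving its box is moved freely; the ones before it in the vector are answered by near.
escape : ∀ {s g} (Γ : System n) → Good s Γ → s ℕ.≤ g → (x : Vec ℤ n) → ¬ Box s s x →
  ∃ λ x′ → Similar Γ x x′ × ¬ Box s g x′ × Box s (s ℕ.* g) x′
escape Γ good s≤g [] out = ⊥-elim (out tt)
escape {s = s} {g} Γ (st , good) s≤g (_∷_ {n} y v) out with box? s s v
... | no v∉ with escape (elim Γ) good s≤g v v∉
...   | v′ , sim , v′∉ , v′∈ with Step.near st {B = s ^ n ℕ.* g} (ℕP.*-mono-≤ (1≤^ n 1≤s) (ℕP.≤-trans 1≤s s≤g)) (box-⊑ 1≤s v′ v′∈) sim y
  where
  1≤s : 1 ℕ.≤ s
  1≤s = Step.1≤s st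
...     | y′ , sim′ , y′≤ = y′ ∷ v′ , sim′ , (λ { (_ , b) → v′∉ b }) , ℕP.≤-trans y′≤ (ℕP.≤-reflexive (swap-mult s (s ^ n) g)) , v′∈
escape {s = s} {g} Γ (st , good) s≤g (_∷_ {n} y v) out | yes v∈
  -- The tail lies in the inner box, so it is bounded by `s ^ n`, while `y` exceeds `s * s ^ n`; `X`
  -- is the side that has to be left.
  with Step.away st {B = s ^ n} {X = s ^ n ℕ.* g} (1≤^ n 1≤s)
         (subst (v ⊑_) (ℕP.*-identityʳ (s ^ n)) (box-⊑ 1≤s v (subst (λ k → Box s k v) (sym (ℕP.*-identityʳ s)) v∈)))
         (subst (ℕ._< ∣ y ∣) (ℕP.*-comm (s ^ n) s) (ℕP.≰⇒> (λ y≤ → out (y≤ , v∈))))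
         (ℕP.≤-trans (ℕP.≤-reflexive (ℕP.*-comm s (s ^ n))) (ℕP.*-monoʳ-≤ (s ^ n) s≤g))
  where
  1≤s : 1 ℕ.≤ s
  1≤s = Step.1≤s st
... | y′ , sim , lo , hi = y′ ∷ v , sim , (λ { (y′≤ , _) → ℕP.<⇒≱ lo y′≤ })
    , ℕP.≤-trans hi (ℕP.≤-reflexive (swap-mult s (s ^ n) g))
    , box-mono v (ℕP.≤-trans s≤g (ℕP.m≤n*m g s {{ℕ.>-nonZero (Step.1≤s st)}})) v∈

-- Invariance of the satisfaction relation

eval : Vec (Poly k) n → Vec ℤ k → Vec ℤ n
eval cs u = map (λ p → evalPoly p u) cs

coeffs : QF k n → List (Poly k)
coeffs (ineq cs c) = c ∷ toList cs
coeffs tt′ = []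
coeffs ff′ = []
coeffs (θ ∧′ η) = coeffs θ List.++ coeffs η
coeffs (θ ∨′ η) = coeffs θ List.++ coeffs η
coeffs (¬′ θ) = coeffs θ

coefficients : PForm k n → List (Poly k)
coefficients (qf θ) = coeffs θ
coefficients (qnt _ φ) = coefficients φ

forms-qf : QF k n → Vec ℤ k → List (Vec ℤ n)
forms-qf (ineq cs c) u = eval cs u ∷ []
forms-qf tt′ u = []
forms-qf ff′ u = []
forms-qf (θ ∧′ η) u = forms-qf θ u List.++ forms-qf η u
forms-qf (θ ∨′ η) u = forms-qf θ u List.++ forms-qf η u
forms-qf (¬′ θ) u = forms-qf θ u

-- The matrix starts with modulus 1; larger moduli come only from denominators. Constants of atoms
-- do not occur in the forms, and are covered by the threshold `T`.
systemOf : PForm k n → Vec ℤ k → ℕ → System n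
systemOf (qf θ) u T = system (forms-qf θ u) T 1
systemOf (qnt _ φ) u T = elim (systemOf φ u T)

agree-≤ : ∀ {T a b c} → Agree (+ T) a b → ∣ c ∣ ℕ.≤ T → a ≤ c → b ≤ c
agree-≤ (inj₁ refl) _ a≤c = a≤c
agree-≤ {T} {a} {b} {c} (inj₂ (inj₁ (T<a , _))) c≤T a≤c =
  ⊥-elim (ℤP.<-irrefl refl (ℤP.<-≤-trans T<a (ℤP.≤-trans a≤c (ℤP.≤-trans (≤∣∣ c) (+≤+ c≤T)))))
agree-≤ {T} {a} {b} {c} (inj₂ (inj₂ (_ , b<-T))) c≤T _ =
  ℤP.≤-trans (ℤP.<⇒≤ b<-T) (subst (- + T ≤_) (ℤP.neg-involutive c) (ℤP.neg-mono-≤ (ℤP.≤-trans (-≤∣∣ c) (+≤+ c≤T))))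

module _ {u : Vec ℤ k} {T : ℕ} where

  BoundedBy : List (Poly k) → Set
  BoundedBy ps = ∀ {p} → p ∈ ps → ∣ evalPoly p u ∣ ℕ.≤ T

  invariant-qf : (θ : QF k n) → BoundedBy (coeffs θ) → ∀ {v w} →
    (∀ {h} → h ∈ forms-qf θ u → Agree (+ T) (linSum h v) (linSum h w)) → ⟦ θ ⟧qf u v ⇔ ⟦ θ ⟧qf u w
  invariant-qf (ineq cs c) b ag = mk⇔ (agree-≤ (ag (here refl)) (b (here refl))) (agree-≤ (agree-sym (ag (here refl))) (b (here refl)))
  invariant-qf tt′ b ag = mk⇔ (λ x → x) (λ x → x)
  invariant-qf ff′ b ag = mk⇔ (λ x → x) (λ x → x)
  invariant-qf (θ ∧′ η) b ag
    with invariant-qf θ (λ p∈ → b (∈P.∈-++⁺ˡ p∈)) (λ h∈ → ag (∈P.∈-++⁺ˡ h∈))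
       | invariant-qf η (λ p∈ → b (∈P.∈-++⁺ʳ (coeffs θ) p∈)) (λ h∈ → ag (∈P.∈-++⁺ʳ (forms-qf θ u) h∈))
  ... | e₁ | e₂ = mk⇔ (λ (x , y) → to e₁ x , to e₂ y) (λ (x , y) → from e₁ x , from e₂ y)
  invariant-qf (θ ∨′ η) b ag
    with invariant-qf θ (λ p∈ → b (∈P.∈-++⁺ˡ p∈)) (λ h∈ → ag (∈P.∈-++⁺ˡ h∈))
       | invariant-qf η (λ p∈ → b (∈P.∈-++⁺ʳ (coeffs θ) p∈)) (λ h∈ → ag (∈P.∈-++⁺ʳ (forms-qf θ u) h∈))
  ... | e₁ | e₂ = mk⇔ (Sum.map (to e₁) (to e₂)) (Sum.map (from e₁) (from e₂))
  invariant-qf (¬′ θ) b ag with invariant-qf θ b ag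
  ... | e = mk⇔ (λ ¬x x → ¬x (from e x)) (λ ¬x x → ¬x (to e x))

  -- Back and forth: for `∃q` the witness on the side of `v` is answered on that of `w`; for `∀q`
  -- the challenge comes on the side of `w` and is answered on that of `v`.
  invariant : (φ : PForm k n) → BoundedBy (coefficients φ) → ∀ {v w} →
    Similar (systemOf φ u T) v w → ⟦ φ ⟧ u v → ⟦ φ ⟧ u w
  invariant (qf θ) b (ag , _) x = to (invariant-qf θ b ag) x
  invariant (qnt ∃q φ) b sim (y , x) =
    let y′ , sim′ , _ = step (systemOf φ u T) sim y in y′ , invariant φ b sim′ x
  invariant (qnt ∀q φ) b sim x y =
    let y′ , sim′ , _ = step (systemOf φ u T) (similar-sym (elim (systemOf φ u T)) sim) y in invariant φ b (similar-sym (systemOf φ u T) sim′) (x y′)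

-- Operations on formulas

dec-qf : (θ : QF k n) (u : Vec ℤ k) (v : Vec ℤ n) → Dec (⟦ θ ⟧qf u v)
dec-qf (ineq cs c) u v = linSum (eval cs u) v ℤP.≤? evalPoly c u
dec-qf tt′ u v = yes tt
dec-qf ff′ u v = no (λ ())
dec-qf (θ ∧′ η) u v = dec-qf θ u v ×-dec dec-qf η u v
dec-qf (θ ∨′ η) u v = dec-qf θ u v ⊎-dec dec-qf η u v
dec-qf (¬′ θ) u v = ¬? (dec-qf θ u v)

-- Abstracting over the place where a zero coefficient is inserted lets a new first variable and a
-- new last variable share one proof.
module Rename {m n : ℕ} (ext : ∀ {A : Set} → A → Vec A m → Vec A n) where

  rename : QF k m → QF k n
  rename (ineq cs c) = ineq (ext (const 0ℤ) cs) c
  rename tt′ = tt′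
  rename ff′ = ff′
  rename (θ ∧′ η) = rename θ ∧′ rename η
  rename (θ ∨′ η) = rename θ ∨′ rename η
  rename (¬′ θ) = ¬′ rename θ

  rename-correct : ∀ {v w} {u : Vec ℤ k} →
    (∀ cs → linSum (eval (ext (const 0ℤ) cs) u) v ≡ linSum (eval cs u) w) →
    (θ : QF k m) → ⟦ rename θ ⟧qf u v ⇔ ⟦ θ ⟧qf u w
  rename-correct {u = u} e (ineq cs c) = mk⇔ (subst (_≤ evalPoly c u) (e cs)) (subst (_≤ evalPoly c u) (sym (e cs)))
  rename-correct e tt′ = mk⇔ (λ x → x) (λ x → x)
  rename-correct e ff′ = mk⇔ (λ x → x) (λ x → x)
  rename-correct e (θ ∧′ η) with rename-correct e θ | rename-correct e η
  ... | e₁ | e₂ = mk⇔ (λ (x , y) → to e₁ x , to e₂ y) (λ (x , y) → from e₁ x , from e₂ y)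
  rename-correct e (θ ∨′ η) with rename-correct e θ | rename-correct e η
  ... | e₁ | e₂ = mk⇔ (Sum.map (to e₁) (to e₂)) (Sum.map (from e₁) (from e₂))
  rename-correct e (¬′ θ) with rename-correct e θ
  ... | e₁ = mk⇔ (λ ¬x x → ¬x (from e₁ x)) (λ ¬x x → ¬x (to e₁ x))

weaken : QF k n → QF k (suc n)
weaken = Rename.rename (λ a cs → a ∷ cs)

weaken-correct : (θ : QF k n) {u : Vec ℤ k} {y : ℤ} {v : Vec ℤ n} → ⟦ weaken θ ⟧qf u (y ∷ v) ⇔ ⟦ θ ⟧qf u v
weaken-correct θ {u} {y} {v} = Rename.rename-correct (λ a cs → a ∷ cs) (λ cs → ℤP.+-identityˡ (linSum (eval cs u) v)) θ

weakenʳ : QF k n → QF k (suc n)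
weakenʳ = Rename.rename (λ a cs → cs ∷ʳ a)

linSum-∷ʳ : ∀ (cs : Vec ℤ n) c v w → linSum (cs ∷ʳ c) (v ∷ʳ w) ≡ linSum cs v + c * w
linSum-∷ʳ [] c [] w = ℤP.+-comm (c * w) 0ℤ
linSum-∷ʳ (d ∷ cs) c (x ∷ v) w = trans (cong (λ r → d * x + r) (linSum-∷ʳ cs c v w)) (sym (ℤP.+-assoc (d * x) (linSum cs v) (c * w)))

linSum-eval-∷ʳ : ∀ (cs : Vec (Poly k) n) c u v w → linSum (eval (cs ∷ʳ c) u) (v ∷ʳ w) ≡ linSum (eval cs u) v + evalPoly c u * w
linSum-eval-∷ʳ cs c u v w = trans (cong (λ h → linSum h (v ∷ʳ w)) (VecP.map-∷ʳ (λ p → evalPoly p u) c cs)) (linSum-∷ʳ (eval cs u) (evalPoly c u) v w)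

weakenʳ-correct : (θ : QF k n) {u : Vec ℤ k} {v : Vec ℤ n} {w : ℤ} → ⟦ weakenʳ θ ⟧qf u (v ∷ʳ w) ⇔ ⟦ θ ⟧qf u v
weakenʳ-correct θ {u} {v} {w} = Rename.rename-correct (λ a cs → cs ∷ʳ a)
  (λ cs → trans (linSum-eval-∷ʳ cs (const 0ℤ) u v w) (ℤP.+-identityʳ (linSum (eval cs u) v))) θ

-- Quantifiers bind at index 0, so a new free variable at the other end passes under them unchanged.
weakenʳ-P : PForm k n → PForm k (suc n)
weakenʳ-P (qf θ) = qf (weakenʳ θ)
weakenʳ-P (qnt q φ) = qnt q (weakenʳ-P φ)

weakenʳ-P-correct : (φ : PForm k n) {u : Vec ℤ k} {v : Vec ℤ n} {w : ℤ} → ⟦ weakenʳ-P φ ⟧ u (v ∷ʳ w) ⇔ ⟦ φ ⟧ u v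
weakenʳ-P-correct (qf θ) = weakenʳ-correct θ
weakenʳ-P-correct (qnt ∃q φ) = mk⇔ (λ (y , x) → y , to (weakenʳ-P-correct φ) x) (λ (y , x) → y , from (weakenʳ-P-correct φ) x)
weakenʳ-P-correct (qnt ∀q φ) = mk⇔ (λ x y → to (weakenʳ-P-correct φ) (x y)) (λ x y → from (weakenʳ-P-correct φ) (x y))

prefix-weakenʳ : (φ : PForm k n) → prefix (weakenʳ-P φ) ≡ prefix φ
prefix-weakenʳ (qf θ) = refl
prefix-weakenʳ (qnt q φ) = cong (q ∷_) (prefix-weakenʳ φ)

relative : Quant → QF k n → QF k n → QF k n
relative ∃q χ θ = χ ∧′ θ
relative ∀q χ θ = (¬′ χ) ∨′ θ

Relative : Quant → Set → Set → Set
Relative ∃q A B = A × B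
Relative ∀q A B = A → B

-- The guard is pushed down to the matrix, which leaves the quantifier prefix as it is.
relative-P : Quant → QF k n → PForm k n → PForm k n
relative-P q χ (qf θ) = qf (relative q χ θ)
relative-P q χ (qnt q′ φ) = qnt q′ (relative-P q (weaken χ) φ)

relative-correct : ∀ q (χ θ : QF k n) {u v} → ⟦ relative q χ θ ⟧qf u v ⇔ Relative q (⟦ χ ⟧qf u v) (⟦ θ ⟧qf u v)
relative-correct ∃q χ θ = mk⇔ (λ x → x) (λ x → x)
relative-correct ∀q χ θ {u} {v} = mk⇔ [ (λ ¬x x → ⊥-elim (¬x x)) , (λ y _ → y) ]′ from′
  where
  from′ : (⟦ χ ⟧qf u v → ⟦ θ ⟧qf u v) → ¬ ⟦ χ ⟧qf u v ⊎ ⟦ θ ⟧qf u v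
  from′ f with dec-qf χ u v
  ... | yes x = inj₂ (f x)
  ... | no ¬x = inj₁ ¬x

-- Moving a guard across a quantifier is sound because the range is inhabited, with 0 as default
-- value; an implication crosses `∃q` constructively because the quantifier-free guard is decidable.
relative-P-correct : ∀ q (χ : QF k n) (φ : PForm k n) {u v} → ⟦ relative-P q χ φ ⟧ u v ⇔ Relative q (⟦ χ ⟧qf u v) (⟦ φ ⟧ u v)
relative-P-correct q χ (qf θ) = relative-correct q χ θ
relative-P-correct ∃q χ (qnt ∃q φ) = mk⇔
  (λ (y , z) → let a , b = to (relative-P-correct ∃q (weaken χ) φ) z in to (weaken-correct χ) a , y , b)
  (λ (a , y , b) → y , from (relative-P-correct ∃q (weaken χ) φ) (from (weaken-correct χ) a , b))
relative-P-correct ∃q χ (qnt ∀q φ) = mk⇔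
  (λ z → to (weaken-correct χ {y = 0ℤ}) (proj₁ (to (relative-P-correct ∃q (weaken χ) φ) (z 0ℤ))) , λ y → proj₂ (to (relative-P-correct ∃q (weaken χ) φ) (z y)))
  (λ (a , b) y → from (relative-P-correct ∃q (weaken χ) φ) (from (weaken-correct χ) a , b y))
relative-P-correct ∀q χ (qnt ∀q φ) = mk⇔
  (λ z a y → to (relative-P-correct ∀q (weaken χ) φ) (z y) (from (weaken-correct χ) a))
  (λ f y → from (relative-P-correct ∀q (weaken χ) φ) (λ a → f (to (weaken-correct χ) a) y))
relative-P-correct ∀q χ (qnt ∃q φ) {u} {v} = mk⇔
  (λ (y , z) a → y , to (relative-P-correct ∀q (weaken χ) φ) z (from (weaken-correct χ) a))
  from′
  where
  from′ : (⟦ χ ⟧qf u v → ⟦ qnt ∃q φ ⟧ u v) → ⟦ relative-P ∀q χ (qnt ∃q φ) ⟧ u v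
  from′ f with dec-qf χ u v
  ... | yes a = let y , b = f a in y , from (relative-P-correct ∀q (weaken χ) φ) (λ _ → b)
  ... | no ¬a = 0ℤ , from (relative-P-correct ∀q (weaken χ) φ) (λ a → ⊥-elim (¬a (to (weaken-correct χ) a)))

prefix-relative : ∀ q (χ : QF k n) φ → prefix (relative-P q χ φ) ≡ prefix φ
prefix-relative q χ (qf θ) = refl
prefix-relative q χ (qnt q′ φ) = cong (q′ ∷_) (prefix-relative q (weaken χ) φ)

block : Quant → ∀ J → PForm k (J ℕ.+ n) → PForm k n
block q zero φ = φ
block q (suc J) φ = block q J (qnt q φ)

Block : Quant → (J : ℕ) → (Vec ℤ J → Set) → Set
Block ∃q J P = Σ (Vec ℤ J) P
Block ∀q J P = (z : Vec ℤ J) → P z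

block-correct : ∀ q J (φ : PForm k (J ℕ.+ n)) {u v} → ⟦ block q J φ ⟧ u v ⇔ Block q J (λ z → ⟦ φ ⟧ u (z Vec.++ v))
block-correct ∃q zero φ = mk⇔ (λ x → [] , x) (λ { ([] , x) → x })
block-correct ∀q zero φ = mk⇔ (λ { x [] → x }) (λ f → f [])
block-correct ∃q (suc J) φ = mk⇔
  (λ x → let z , y , x′ = to (block-correct ∃q J (qnt ∃q φ)) x in y ∷ z , x′)
  (λ { (y ∷ z , x) → from (block-correct ∃q J (qnt ∃q φ)) (z , y , x) })
block-correct ∀q (suc J) φ = mk⇔
  (λ { x (y ∷ z) → to (block-correct ∀q J (qnt ∀q φ)) x z y })
  (λ f → from (block-correct ∀q J (qnt ∀q φ)) (λ z y → f (y ∷ z)))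

prefix-block : ∀ q J (φ : PForm k (J ℕ.+ n)) → prefix (block q J φ) ≡ List.replicate J q List.++ prefix φ
prefix-block q zero φ = refl
prefix-block q (suc J) φ = trans (prefix-block q J (qnt q φ)) (snoc J)
  where
  snoc : ∀ J → List.replicate J q List.++ (q ∷ prefix φ) ≡ q ∷ (List.replicate J q List.++ prefix φ)
  snoc zero = refl
  snoc (suc J) = cong (q ∷_) (snoc J)

-- Balanced digits

-- The number `Lo + P (z + S Hi)` with `P = e + 1` and `S = f + 1` is doubled, so that balanced
-- digits need no halving: `2 Lo` lies strictly between `- P` and `P`, and `2 z` strictly between
-- `- S` and `S`. Then `rem`, the double of the part below `Hi`, lies strictly between `- Q` and
-- `Q`.
module Decode (e f : ℕ) (Lo z Hi : ℤ) (Lo≤ : ∣ Lo ∣ ℕ.* 2 ℕ.≤ e) (z≤ : ∣ z ∣ ℕ.* 2 ℕ.≤ f) where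

  Q : ℕ
  Q = suc f ℕ.* suc e

  val : ℤ → ℤ
  val a = + 2 * (Lo + + suc e * (z + + suc f * Hi)) - + 2 * + Q * a

  rem : ℤ
  rem = + 2 * Lo + + suc e * (+ 2 * z)

  val-rem : ∀ a → val a ≡ rem + + 2 * + Q * (Hi - a)
  val-rem a = subst (λ q → + 2 * (Lo + + suc e * (z + + suc f * Hi)) - + 2 * q * a ≡ rem + + 2 * q * (Hi - a))
    (sym (ℤP.pos-* (suc f) (suc e))) (l Lo (+ suc e) z (+ suc f) Hi a)
    where l : ∀ Lo P z S Hi a → + 2 * (Lo + P * (z + S * Hi)) - + 2 * (S * P) * a ≡ (+ 2 * Lo + P * (+ 2 * z)) + + 2 * (S * P) * (Hi - a)
          l = solve-∀

  val-Hi : val Hi ≡ rem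
  val-Hi = trans (val-rem Hi) (l rem (+ 2 * + Q) Hi)
    where l : ∀ r q h → r + q * (h - h) ≡ r
          l = solve-∀

  ∣2*∣ : ∀ x → ∣ + 2 * x ∣ ≡ ∣ x ∣ ℕ.* 2
  ∣2*∣ x = trans (ℤP.∣i*j∣≡∣i∣*∣j∣ (+ 2) x) (ℕP.*-comm 2 ∣ x ∣)

  rem≤ : ∣ rem ∣ ℕ.≤ e ℕ.+ f ℕ.* suc e
  rem≤ = ℕP.≤-trans (ℤP.∣i+j∣≤∣i∣+∣j∣ (+ 2 * Lo) _) (ℕP.+-mono-≤ (subst (ℕ._≤ e) (sym (∣2*∣ Lo)) Lo≤)
    (subst (ℕ._≤ f ℕ.* suc e) (sym (trans (ℤP.∣i*j∣≡∣i∣*∣j∣ (+ suc e) (+ 2 * z)) (trans (cong (suc e ℕ.*_) (∣2*∣ z)) (ℕP.*-comm (suc e) _))))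
      (ℕP.*-monoˡ-≤ (suc e) z≤)))

  -- Q is suc (e + f * suc e) by computation.
  rem-upper : rem ≤ + Q + -1ℤ
  rem-upper = ℤP.≤-trans (≤∣∣ rem) (+≤+ rem≤)

  rem-lower : - rem ≤ + Q + -1ℤ
  rem-lower = ℤP.≤-trans (-≤∣∣ rem) (+≤+ rem≤)

  valid-upper : val Hi ≤ + Q + -1ℤ
  valid-upper = subst (_≤ + Q + -1ℤ) (sym val-Hi) rem-upper

  absurd : ∀ {x y j} → x ≤ y → y - x ≡ - + suc j → ⊥
  absurd {x} {y} {j} x≤y e with shift-≤ {x = x} {y = y} {b = - + suc j} {a = 0ℤ} x≤y (trans e (sym (ℤP.+-identityʳ _)))
  ... | ()

  valid-lower : ¬ (val Hi ≤ - + Q)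
  valid-lower h = absurd {j = 0} (ℤP.+-mono-≤ (subst (_≤ - + Q) val-Hi h) rem-lower) (l rem (+ Q))
    where l : ∀ r Q → (- Q + (Q + -1ℤ)) - (r + - r) ≡ - + 1
          l = solve-∀

  -- A unit change of `a` moves `val a` by `2 Q`, more than the distance between any two integers
  -- strictly between `- Q` and `Q`.
  valid-unique : ∀ a → val a ≤ + Q + -1ℤ → ¬ (val a ≤ - + Q) → a ≡ Hi
  valid-unique a up lo with Hi - a in eq
  ... | + zero = sym (l Hi a eq)
    where
    l₀ : ∀ h a → h ≡ (h - a) + a
    l₀ = solve-∀
    l : ∀ h a → h - a ≡ 0ℤ → h ≡ a
    l h a e = trans (l₀ h a) (trans (cong (_+ a) e) (ℤP.+-identityˡ a))
  ... | +[1+ j ] = ⊥-elim (absurd {j = suc (j ℕ.* (2 ℕ.* Q))} (ℤP.+-mono-≤ up′ rem-lower)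
      (trans (cong (λ t → ((+ Q + -1ℤ) + (+ Q + -1ℤ)) - ((rem + + 2 * + Q * t) + - rem)) (ℤP.pos-+ 1 j))
      (trans (l rem (+ Q) (+ j)) (cong (λ t → - (+ 2 + t)) (trans (cong (+ j *_) (sym (ℤP.pos-* 2 Q))) (sym (ℤP.pos-* j (2 ℕ.* Q))))))))
    where
    up′ : rem + + 2 * + Q * +[1+ j ] ≤ + Q + -1ℤ
    up′ = subst (_≤ + Q + -1ℤ) (trans (val-rem a) (cong (λ t → rem + + 2 * + Q * t) eq)) up
    l : ∀ r Q j → ((Q + -1ℤ) + (Q + -1ℤ)) - ((r + + 2 * Q * (1ℤ + j)) + - r) ≡ - (+ 2 + j * (+ 2 * Q))
    l = solve-∀
  ... | -[1+ j ] = ⊥-elim (lo (subst (_≤ - + Q) (sym (trans (val-rem a) (cong (λ t → rem + + 2 * + Q * t) eq)))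
      (shift-≤ {x = rem} {y = (+ Q + -1ℤ) + + suc (j ℕ.* (2 ℕ.* Q))} (ℤP.≤-trans rem-upper (ℤP.i≤i+j (+ Q + -1ℤ) (+ suc (j ℕ.* (2 ℕ.* Q)))))
        (trans (cong (λ t → ((+ Q + -1ℤ) + t) - rem) (trans (ℤP.pos-+ 1 (j ℕ.* (2 ℕ.* Q))) (cong (λ t → 1ℤ + t) (trans (ℤP.pos-* j (2 ℕ.* Q)) (cong (+ j *_) (ℤP.pos-* 2 Q))))))
          (trans (l rem (+ Q) (+ j)) (cong (λ t → - + Q - (rem + + 2 * + Q * - t)) (sym (ℤP.pos-+ 1 j))))))))
    where
    l : ∀ r Q j → ((Q + -1ℤ) + (1ℤ + j * (+ 2 * Q))) - r ≡ - Q - (r + + 2 * Q * - (1ℤ + j))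
    l = solve-∀

  -- The digit outweighs what is below it: `rem` is `2 Lo + P (2 z)`, at most `P - 1` if `z ≤ 0`,
  -- and at least `2 P - (P - 1)` if `z ≥ 1`.
  sign-digit : val Hi ≤ + suc e + -1ℤ ⇔ z ≤ 0ℤ
  sign-digit = mk⇔ (λ h → fwd z refl (subst (_≤ + e) val-Hi h)) (λ h → subst (_≤ + e) (sym val-Hi) (bwd z refl h))
    where
    2Lo≤ : + 2 * Lo ≤ + e
    2Lo≤ = ℤP.≤-trans (≤∣∣ (+ 2 * Lo)) (+≤+ (subst (ℕ._≤ e) (sym (∣2*∣ Lo)) Lo≤))
    -2Lo≤ : - (+ 2 * Lo) ≤ + e
    -2Lo≤ = ℤP.≤-trans (-≤∣∣ (+ 2 * Lo)) (+≤+ (subst (ℕ._≤ e) (sym (∣2*∣ Lo)) Lo≤))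
    fwd : ∀ z′ → z′ ≡ z → rem ≤ + e → z′ ≤ 0ℤ
    fwd (+ zero) _ _ = ℤP.≤-refl
    fwd -[1+ j ] _ _ = -≤+
    fwd +[1+ j ] ez h = ⊥-elim (absurd {j = suc (j ℕ.* (2 ℕ.* suc e))} (ℤP.+-mono-≤ h -2Lo≤)
      (trans (cong (λ t → (+ e + + e) - ((+ 2 * Lo + + suc e * (+ 2 * t)) + - (+ 2 * Lo))) (trans (sym ez) (ℤP.pos-+ 1 j)))
      (trans (cong (λ t → (+ e + + e) - ((+ 2 * Lo + t * (+ 2 * (1ℤ + + j))) + - (+ 2 * Lo))) (ℤP.pos-+ 1 e))
      (trans (l Lo (+ e) (+ j)) (cong (λ t → - (+ 2 + t)) (trans (cong (λ t → + j * (+ 2 * t)) (sym (ℤP.pos-+ 1 e))) (trans (cong (+ j *_) (sym (ℤP.pos-* 2 (suc e)))) (sym (ℤP.pos-* j (2 ℕ.* suc e))))))))))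
      where
      l : ∀ L e j → (e + e) - ((+ 2 * L + (1ℤ + e) * (+ 2 * (1ℤ + j))) + - (+ 2 * L)) ≡ - (+ 2 + j * (+ 2 * (1ℤ + e)))
      l = solve-∀
    bwd : ∀ z′ → z′ ≡ z → z′ ≤ 0ℤ → rem ≤ + e
    bwd z′ refl h = ℤP.≤-trans (ℤP.+-monoʳ-≤ (+ 2 * Lo) (ℤP.≤-trans (ℤP.*-monoˡ-≤-nonNeg (+ suc e) (ℤP.*-monoˡ-≤-nonNeg (+ 2) h)) (ℤP.≤-reflexive (ℤP.*-zeroʳ (+ suc e)))))
      (subst (_≤ + e) (sym (ℤP.+-identityʳ (+ 2 * Lo))) 2Lo≤)

-- Complementary positions: multiplying the packed number by base ^ offset m moves the digit at m to position length ps.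
offset : ∀ {p : A} {ps} → p ∈ ps → ℕ
offset {ps = _ ∷ ps} (here _) = suc (length ps)
offset (there m) = offset m

toList-⊆ : ∀ {p : A} {cs : Vec A n} {ps} → p List.∷ toList cs ⊆ ps → toList cs ⊆ ps
toList-⊆ inc p∈ = inc (there p∈)

module Digits (ev : A → ℤ) (W s : ℕ) where

  f : ℕ
  f = W ℕ.* s

  base : ℕ
  base = suc f

  horner : List A → ℤ
  horner [] = 0ℤ
  horner (p ∷ ps) = ev p + + base * horner ps

  1≤base^ : ∀ i → 1 ℕ.≤ base ^ i
  1≤base^ i = ℕP.m^n>0 base i

  -- The summand `base ^ offset i` is the slack that closes the induction: a further digit below
  -- adds at most `s * base ^ offset i` to the low part, and `1 + W * s` is `base`.
  digit : ∀ {p ps} → (∀ {q} → q ∈ ps → ∣ ev q ∣ ℕ.≤ s) → (i : p ∈ ps) → ∃ λ lo → ∃ λ hi →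
    + (base ^ offset i) * horner ps ≡ lo + + (base ^ length ps) * (ev p + + base * hi) ×
    W ℕ.* ∣ lo ∣ ℕ.+ base ^ offset i ℕ.≤ base ^ length ps
  digit {p} {ps = p ∷ ps} small (here refl) = 0ℤ , horner ps , sym (ℤP.+-identityˡ _) ,
    ℕP.≤-reflexive (cong (ℕ._+ base ^ suc (length ps)) (ℕP.*-zeroʳ W))
  digit {p} {ps = q ∷ ps} small (there i) with digit {p} {ps} (λ q∈ → small (there q∈)) i
  ... | lo , hi , eq , bd = + B * ev q + + base * lo , hi , eq′ , bd′
    where
    B : ℕ
    B = base ^ offset i
    P : ℕ
    P = base ^ length ps
    l₁ : ∀ B q base h → B * (q + base * h) ≡ B * q + base * (B * h)
    l₁ = solve-∀
    l₂ : ∀ x base lo P d → x + base * (lo + P * d) ≡ (x + base * lo) + base * P * d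
    l₂ = solve-∀
    eq′ : + B * (ev q + + base * horner ps) ≡ (+ B * ev q + + base * lo) + + (base ℕ.* P) * (ev p + + base * hi)
    eq′ = trans (l₁ (+ B) (ev q) (+ base) (horner ps)) (trans (cong (λ t → + B * ev q + + base * t) eq)
      (trans (l₂ (+ B * ev q) (+ base) lo (+ P) (ev p + + base * hi))
        (cong (λ t → (+ B * ev q + + base * lo) + t * (ev p + + base * hi)) (sym (ℤP.pos-* base P)))))
    lo≤ : ∣ + B * ev q + + base * lo ∣ ℕ.≤ B ℕ.* s ℕ.+ base ℕ.* ∣ lo ∣
    lo≤ = ℕP.≤-trans (ℤP.∣i+j∣≤∣i∣+∣j∣ (+ B * ev q) (+ base * lo)) (ℕP.+-mono-≤
      (ℕP.≤-trans (ℕP.≤-reflexive (ℤP.∣i*j∣≡∣i∣*∣j∣ (+ B) (ev q))) (ℕP.*-monoʳ-≤ B (small (here refl))))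
      (ℕP.≤-reflexive (ℤP.∣i*j∣≡∣i∣*∣j∣ (+ base) lo)))
    l₃ : ∀ W s B a → W ℕ.* (B ℕ.* s ℕ.+ (1 ℕ.+ W ℕ.* s) ℕ.* a) ℕ.+ B ≡ (1 ℕ.+ W ℕ.* s) ℕ.* (W ℕ.* a ℕ.+ B)
    l₃ = ℕSolver.solve-∀
    bd′ : W ℕ.* ∣ + B * ev q + + base * lo ∣ ℕ.+ B ℕ.≤ base ℕ.* P
    bd′ = ℕP.≤-trans (ℕP.+-monoˡ-≤ B (ℕP.*-monoʳ-≤ W lo≤)) (ℕP.≤-trans (ℕP.≤-reflexive (l₃ W s B ∣ lo ∣)) (ℕP.*-monoʳ-≤ base bd))

  module _ {ps : List A} (small : ∀ {q} → q ∈ ps → ∣ ev q ∣ ℕ.≤ s) where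

    shifted : (cs : Vec A m) → toList cs ⊆ ps → Vec ℤ m
    shifted [] inc = []
    shifted (p ∷ cs) inc = + (base ^ offset (inc (here refl))) * horner ps ∷ shifted cs (toList-⊆ {cs = cs} inc)

    digit-sum : ∀ {e X} → base ^ length ps ≡ suc e → (cs : Vec A m) (inc : toList cs ⊆ ps) {v : Vec ℤ m} → v ⊑ X →
      ∃ λ Lo → ∃ λ Hi → linSum (shifted cs inc) v ≡ Lo + + (base ^ length ps) * (linSum (map ev cs) v + + base * Hi)
        × W ℕ.* ∣ Lo ∣ ℕ.≤ m ℕ.* (X ℕ.* e)
    digit-sum eP [] inc [] = 0ℤ , 0ℤ , l (+ (base ^ length ps)) (+ base) , ℕP.≤-reflexive (ℕP.*-zeroʳ W)
      where l : ∀ P base → 0ℤ ≡ 0ℤ + P * (0ℤ + base * 0ℤ)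
            l = solve-∀
    digit-sum {e = e} {X} eP (p ∷ cs) inc {x ∷ v} (x≤ ∷ v≤)
      with digit small (inc (here refl)) | digit-sum eP cs (toList-⊆ {cs = cs} inc) v≤
    ... | lo , hi , eq , bd | Lo , Hi , eq′ , bd′ = lo * x + Lo , hi * x + Hi ,
        trans (cong₂ (λ a base → a * x + base) eq eq′) (l lo (+ (base ^ length ps)) (ev p) (+ base) hi x Lo (linSum (map ev cs) v) Hi) ,
        ℕP.≤-trans (ℕP.*-monoʳ-≤ W (ℤP.∣i+j∣≤∣i∣+∣j∣ (lo * x) Lo)) (ℕP.≤-trans (ℕP.≤-reflexive (ℕP.*-distribˡ-+ W ∣ lo * x ∣ ∣ Lo ∣))
          (ℕP.+-mono-≤ (ℕP.≤-trans (ℕP.≤-reflexive (trans (cong (W ℕ.*_) (ℤP.∣i*j∣≡∣i∣*∣j∣ lo x)) (trans (sym (ℕP.*-assoc W ∣ lo ∣ ∣ x ∣)) (ℕP.*-comm _ ∣ x ∣))))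
            (ℕP.*-mono-≤ x≤ Wlo≤)) bd′))
      where
      l : ∀ lo P p base hi x Lo r Hi → (lo + P * (p + base * hi)) * x + (Lo + P * (r + base * Hi)) ≡ (lo * x + Lo) + P * ((p * x + r) + base * (hi * x + Hi))
      l = solve-∀
      Wlo≤ : W ℕ.* ∣ lo ∣ ℕ.≤ e
      Wlo≤ = ℕP.+-cancelʳ-≤ 1 _ _ (ℕP.≤-trans (ℕP.+-monoʳ-≤ (W ℕ.* ∣ lo ∣) (1≤base^ (offset (inc (here refl)))))
        (ℕP.≤-trans bd (ℕP.≤-reflexive (trans eP (ℕP.+-comm 1 e)))))

-- The packed parameter and the encoding of atoms

pow : Poly k → ℕ → Poly k
pow p zero = const 1ℤ
pow p (suc i) = p ⊗ pow p i

eval-pow : ∀ {p : Poly k} {u b} → evalPoly p u ≡ + b → ∀ i → evalPoly (pow p i) u ≡ + (b ^ i)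
eval-pow e zero = refl
eval-pow {b = b} e (suc i) = trans (cong₂ _*_ e (eval-pow e i)) (sym (ℤP.pos-* b (b ^ i)))

basePoly : Poly k → ℕ → Poly k
basePoly p n = const 1ℤ ⊕ (((const (+ suc n) ⊗ (pow p n ⊗ p)) ⊗ const (+ 2)) ⊗ p)

-- The number of terms of an atom with its constant, times the bound on a variable in the outer box,
-- times 2 for balanced digits; multiplied by `s`, it bounds twice the digit to be read.
width : ℕ → ℕ → ℕ
width n s = suc n ℕ.* (s ^ n ℕ.* s) ℕ.* 2

eval-base : ∀ {p : Poly k} {u s} n → evalPoly p u ≡ + s → evalPoly (basePoly p n) u ≡ + suc (width n s ℕ.* s)
eval-base {p = p} {u} {s} n e = cong (λ t → 1ℤ + t)
  (mul _ (evalPoly p u) (suc n ℕ.* (s ^ n ℕ.* s) ℕ.* 2) s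
    (mul _ (+ 2) (suc n ℕ.* (s ^ n ℕ.* s)) 2
      (mul (+ suc n) _ (suc n) (s ^ n ℕ.* s) refl (mul (evalPoly (pow p n) u) (evalPoly p u) (s ^ n) s (eval-pow {p = p} e n) e)) refl) e)
  where
  mul : ∀ x y a b → x ≡ + a → y ≡ + b → x * y ≡ + (a ℕ.* b)
  mul _ _ a b refl refl = sym (ℤP.pos-* a b)

hornerPoly : Poly k → List (Poly k) → Poly k
hornerPoly S [] = const 0ℤ
hornerPoly S (p ∷ ps) = p ⊕ (S ⊗ hornerPoly S ps)

eval-horner : ∀ (S : Poly k) {u W s} → evalPoly S u ≡ + suc (W ℕ.* s) → ∀ ps →
  evalPoly (hornerPoly S ps) u ≡ Digits.horner (λ p → evalPoly p u) W s ps
eval-horner S e [] = refl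
eval-horner S {u} e (p ∷ ps) = cong (λ t → evalPoly p u + t) (cong₂ _*_ e (eval-horner S e ps))

linSum-++ : ∀ (cs : Vec ℤ m) (ds : Vec ℤ n) z v → linSum (cs ++ ds) (z ++ v) ≡ linSum cs z + linSum ds v
linSum-++ [] ds [] v = sym (ℤP.+-identityˡ _)
linSum-++ (c ∷ cs) ds (x ∷ z) v = trans (cong (λ t → c * x + t) (linSum-++ cs ds z v)) (sym (ℤP.+-assoc (c * x) _ _))

unit : Fin m → Poly k → Vec (Poly k) m
unit zero p = p ∷ replicate _ (const 0ℤ)
unit (suc i) p = const 0ℤ ∷ unit i p

linSum-zeros : ∀ (u : Vec ℤ k) (z : Vec ℤ m) → linSum (eval (replicate m (const 0ℤ)) u) z ≡ 0ℤ
linSum-zeros u [] = refl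
linSum-zeros u (x ∷ z) = trans (ℤP.+-identityˡ _) (linSum-zeros u z)

linSum-unit : ∀ (i : Fin m) (p : Poly k) u z → linSum (eval (unit i p) u) z ≡ evalPoly p u * lookup z i
linSum-unit zero p u (x ∷ z) = trans (cong (λ t → evalPoly p u * x + t) (linSum-zeros u z)) (ℤP.+-identityʳ _)
linSum-unit (suc i) p u (x ∷ z) = trans (ℤP.+-identityˡ _) (linSum-unit i p u z)

size : QF k n → ℕ
size (ineq _ _) = 1
size tt′ = 0
size ff′ = 0
size (θ ∧′ η) = size θ ℕ.+ size η
size (θ ∨′ η) = size θ ℕ.+ size η
size (¬′ θ) = size θ

module Encode {k n : ℕ} (ps : List (Poly k)) where

  S : Poly 2
  S = basePoly (var zero) n

  scaled : (cs : Vec (Poly k) m) → toList cs ⊆ ps → Vec (Poly 2) m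
  scaled [] inc = []
  scaled (p ∷ cs) inc = const (+ 2) ⊗ (pow S (offset (inc (here refl))) ⊗ var (suc zero)) ∷ scaled cs (toList-⊆ {cs = cs} inc)

  full half : Poly 2
  full = pow S (suc (length ps))
  half = pow S (length ps)

  -- Says 2L - 2S^(E+1) z_i ≤ K, where L is the packed number contracted against (-1 , x), so that its digit at
  -- position E = length ps is cs · x - c.
  below : Fin J → (cs : Vec (Poly k) (suc n)) → toList cs ⊆ ps → Poly 2 → QF 2 (J ℕ.+ n)
  below i cs inc K = ineq (unit i (⊖ (const (+ 2) ⊗ pow S (suc (length ps)))) ++ Vec.tail (scaled cs inc)) (K ⊕ Vec.head (scaled cs inc))

  -- Pins each auxiliary variable to the quotient of its atom. Conjunction is used under every
  -- connective, so all of them are determined whatever the truth values of the atoms.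
  valid : (θ : QF k n) → coeffs θ ⊆ ps → (Fin (size θ) → Fin J) → QF 2 (J ℕ.+ n)
  valid (ineq cs c) inc ι = below (ι zero) (c ∷ cs) inc (full ⊕ const -1ℤ)
    ∧′ (¬′ below (ι zero) (c ∷ cs) inc (⊖ full))
  valid tt′ inc ι = tt′
  valid ff′ inc ι = tt′
  valid (θ ∧′ η) inc ι = valid θ (inc ∘ ∈P.∈-++⁺ˡ) (ι ∘ (_↑ˡ size η)) ∧′ valid η (inc ∘ ∈P.∈-++⁺ʳ (coeffs θ)) (ι ∘ (size θ ↑ʳ_))
  valid (θ ∨′ η) inc ι = valid θ (inc ∘ ∈P.∈-++⁺ˡ) (ι ∘ (_↑ˡ size η)) ∧′ valid η (inc ∘ ∈P.∈-++⁺ʳ (coeffs θ)) (ι ∘ (size θ ↑ʳ_))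
  valid (¬′ θ) inc ι = valid θ inc ι

  encode : (θ : QF k n) → coeffs θ ⊆ ps → (Fin (size θ) → Fin J) → QF 2 (J ℕ.+ n)
  encode (ineq cs c) inc ι = below (ι zero) (c ∷ cs) inc (half ⊕ const -1ℤ)
  encode tt′ inc ι = tt′
  encode ff′ inc ι = ff′
  encode (θ ∧′ η) inc ι = encode θ (inc ∘ ∈P.∈-++⁺ˡ) (ι ∘ (_↑ˡ size η)) ∧′ encode η (inc ∘ ∈P.∈-++⁺ʳ (coeffs θ)) (ι ∘ (size θ ↑ʳ_))
  encode (θ ∨′ η) inc ι = encode θ (inc ∘ ∈P.∈-++⁺ˡ) (ι ∘ (_↑ˡ size η)) ∨′ encode η (inc ∘ ∈P.∈-++⁺ʳ (coeffs θ)) (ι ∘ (size θ ↑ʳ_))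
  encode (¬′ θ) inc ι = ¬′ encode θ inc ι

  module Correct (u : Vec ℤ k) (s : ℕ) (1≤s : 1 ℕ.≤ s) (small : ∀ {p} → p ∈ ps → ∣ evalPoly p u ∣ ℕ.≤ s) where

    open Digits (λ p → evalPoly p u) (width n s) s

    par : Vec ℤ 2
    par = + s ∷ horner ps ∷ []

    E : ℕ
    E = length ps

    eval-powS : ∀ i → evalPoly (pow S i) par ≡ + (base ^ i)
    eval-powS = eval-pow {p = S} (eval-base {p = var zero} n refl)

    head-scaled : (cs : Vec (Poly k) (suc m)) (inc : toList cs ⊆ ps) →
      evalPoly (Vec.head (scaled cs inc)) par ≡ + 2 * Vec.head (shifted small cs inc)
    head-scaled (p ∷ cs) inc = cong (λ t → + 2 * (t * horner ps)) (eval-powS (offset (inc (here refl))))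

    linSum-scaled : (cs : Vec (Poly k) m) (inc : toList cs ⊆ ps) (v : Vec ℤ m) →
      linSum (eval (scaled cs inc) par) v ≡ + 2 * linSum (shifted small cs inc) v
    linSum-scaled [] inc [] = refl
    linSum-scaled (p ∷ cs) inc (x ∷ v) = trans (cong₂ (λ a r → a * x + r) (head-scaled (p ∷ cs) inc) (linSum-scaled cs (toList-⊆ {cs = cs} inc) v))
      (l (Vec.head (shifted small (p ∷ cs) inc)) x _)
      where l : ∀ a x r → + 2 * a * x + + 2 * r ≡ + 2 * (a * x + r)
            l = solve-∀

    packed : (cs : Vec (Poly k) (suc m)) → toList cs ⊆ ps → Vec ℤ m → ℤ
    packed cs inc v = linSum (shifted small cs inc) (-1ℤ ∷ v)

    below-correct : ∀ (i : Fin J) (cs : Vec (Poly k) (suc n)) (inc : toList cs ⊆ ps) K z v →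
      ⟦ below i cs inc K ⟧qf par (z ++ v) ⇔ + 2 * packed cs inc v - + 2 * + (base ^ suc E) * lookup z i ≤ evalPoly K par
    below-correct i cs@(p ∷ cs′) inc K z v = mk⇔ (λ h → shift-≤ h eq) (λ h → shift-≤ h (sym eq))
      where
      B a₀ zᵢ : ℤ
      B = + (base ^ suc E)
      a₀ = Vec.head (shifted small cs inc)
      zᵢ = lookup z i
      r : ℤ
      r = linSum (shifted small cs′ (toList-⊆ {cs = cs′} inc)) v
      lhs : linSum (eval (unit i (⊖ (const (+ 2) ⊗ pow S (suc E))) ++ Vec.tail (scaled cs inc)) par) (z ++ v) ≡ - (+ 2 * B) * zᵢ + + 2 * r
      lhs = trans (cong (λ h → linSum h (z ++ v)) (VecP.map-++ _ (unit i _) (Vec.tail (scaled cs inc))))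
        (trans (linSum-++ (eval (unit i _) par) _ z v)
          (cong₂ _+_ (trans (linSum-unit i _ par z) (cong (λ t → - (+ 2 * t) * zᵢ) (eval-powS (suc E)))) (linSum-scaled cs′ (toList-⊆ {cs = cs′} inc) v)))
      l : ∀ K a B x r → (K + + 2 * a) - (- (+ 2 * B) * x + + 2 * r) ≡ K - (+ 2 * (a * -1ℤ + r) - + 2 * B * x)
      l = solve-∀
      eq : (evalPoly K par + evalPoly (Vec.head (scaled cs inc)) par)
           - linSum (eval (unit i (⊖ (const (+ 2) ⊗ pow S (suc E))) ++ Vec.tail (scaled cs inc)) par) (z ++ v)
         ≡ evalPoly K par - (+ 2 * packed cs inc v - + 2 * B * zᵢ)
      eq = trans (cong₂ (λ h t → (evalPoly K par + h) - t) (head-scaled cs inc) lhs) (l (evalPoly K par) a₀ B zᵢ r)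

    -- `sol` is the only valid choice of auxiliary values. Quantifying over the placement `ι` lets
    -- the two halves of a formula read their own parts of one common vector.
    record Solves (θ : QF k n) (inc : coeffs θ ⊆ ps) (v : Vec ℤ n) (sol : Vec ℤ (size θ)) : Set where
      field
        sound    : ∀ {J} (ι : Fin (size θ) → Fin J) z → (∀ a → lookup z (ι a) ≡ lookup sol a) →
          ⟦ valid θ inc ι ⟧qf par (z ++ v) × (⟦ encode θ inc ι ⟧qf par (z ++ v) ⇔ ⟦ θ ⟧qf u v)
        complete : ∀ {J} (ι : Fin (size θ) → Fin J) z →
          ⟦ valid θ inc ι ⟧qf par (z ++ v) → ∀ a → lookup z (ι a) ≡ lookup sol a

    open Solves

    X : ℕ
    X = s ^ n ℕ.* s

    1≤X : 1 ℕ.≤ X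
    1≤X = ℕP.*-mono-≤ (1≤^ n 1≤s) 1≤s

    eval-⊑ : (cs : Vec (Poly k) m) → toList cs ⊆ ps → eval cs u ⊑ s
    eval-⊑ [] inc = []
    eval-⊑ (p ∷ cs) inc = small (inc (here refl)) ∷ eval-⊑ cs (toList-⊆ {cs = cs} inc)

    pred-eq : ∀ {x} → 1 ℕ.≤ x → ∃ λ e → x ≡ suc e
    pred-eq {suc e} _ = e , refl

    solve-ineq : ∀ cs c (inc : coeffs (ineq cs c) ⊆ ps) {v} → v ⊑ X → ∃ (Solves (ineq cs c) inc v)
    solve-ineq cs c inc {v} v≤ with pred-eq (1≤base^ E)
    ... | e , P≡ with digit-sum small P≡ (c ∷ cs) inc {v = -1ℤ ∷ v} (1≤X ∷ v≤)
    ... | Lo , Hi , L≡ , Lo≤ = Hi ∷ [] , record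
        { sound = λ ι z eqs →
            ( from (top-val (ι zero) z) (subst (λ a → val a ≤ + Q + -1ℤ) (sym (eqs zero)) valid-upper)
            , λ h → valid-lower (subst (λ a → val a ≤ - + Q) (eqs zero) (to (bottom-val (ι zero) z) h)))
            , mk⇔ (λ h → digit-≤ (to sign-digit (subst (λ a → val a ≤ + suc e + -1ℤ) (eqs zero) (to (mid-val (ι zero) z) h))))
                  (λ h → from (mid-val (ι zero) z) (subst (λ a → val a ≤ + suc e + -1ℤ) (sym (eqs zero)) (from sign-digit (≤-digit h))))
        ; complete = λ { ι z (up , lo) zero → valid-unique (lookup z (ι zero))
            (to (top-val (ι zero) z) up) (λ h → lo (from (bottom-val (ι zero) z) h)) }
        }
      where
      d : ℤ
      d = linSum (eval (c ∷ cs) u) (-1ℤ ∷ v)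
      -- `width n s` is `suc n * X * 2`: the factor `suc n * X` cancels against the growth from
      -- contraction, and the 2 remains.
      2Lo≤e : ∣ Lo ∣ ℕ.* 2 ℕ.≤ e
      2Lo≤e = ℕP.*-cancelˡ-≤ (suc n ℕ.* X) {{ℕ.>-nonZero (ℕP.*-mono-≤ {1} {suc n} (ℕ.s≤s ℕ.z≤n) 1≤X)}}
        (ℕP.≤-trans (ℕP.≤-reflexive (l (suc n ℕ.* X) ∣ Lo ∣)) (ℕP.≤-trans Lo≤ (ℕP.≤-reflexive (sym (ℕP.*-assoc (suc n) X e)))))
        where l : ∀ w a → w ℕ.* (a ℕ.* 2) ≡ w ℕ.* 2 ℕ.* a
              l = ℕSolver.solve-∀
      2d≤f : ∣ d ∣ ℕ.* 2 ℕ.≤ f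
      2d≤f = ℕP.≤-trans (ℕP.*-monoˡ-≤ 2 (linSum-bound (eval-⊑ (c ∷ cs) inc) (1≤X ∷ v≤)))
        (ℕP.≤-reflexive (l (suc n) s X))
        where l : ∀ m s X → m ℕ.* (s ℕ.* X) ℕ.* 2 ≡ m ℕ.* X ℕ.* 2 ℕ.* s
              l = ℕSolver.solve-∀
      open Decode e f Lo d Hi 2Lo≤e 2d≤f
      Q≡ : base ^ suc E ≡ Q
      Q≡ = cong (base ℕ.*_) P≡
      below-val : ∀ {J} (i : Fin J) K {r} → evalPoly K par ≡ r → ∀ z → ⟦ below i (c ∷ cs) inc K ⟧qf par (z ++ v) ⇔ val (lookup z i) ≤ r
      below-val i K refl z = mk⇔ (λ h → subst (_≤ evalPoly K par) eq (to (below-correct i (c ∷ cs) inc K z v) h))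
                                 (λ h → from (below-correct i (c ∷ cs) inc K z v) (subst (_≤ evalPoly K par) (sym eq) h))
        where
        eq : + 2 * packed (c ∷ cs) inc v - + 2 * + (base ^ suc E) * lookup z i ≡ val (lookup z i)
        eq = cong₂ (λ L q → + 2 * L - + 2 * + q * lookup z i)
          (trans L≡ (cong (λ P → Lo + + P * (d + + base * Hi)) P≡)) Q≡
      eval-full : evalPoly full par ≡ + Q
      eval-full = trans (eval-powS (suc E)) (cong +_ Q≡)
      top-val : ∀ {J} (i : Fin J) z → ⟦ below i (c ∷ cs) inc (full ⊕ const -1ℤ) ⟧qf par (z ++ v) ⇔ val (lookup z i) ≤ + Q + -1ℤ
      top-val i = below-val i (full ⊕ const -1ℤ) (cong (λ t → t + -1ℤ) eval-full)
      bottom-val : ∀ {J} (i : Fin J) z → ⟦ below i (c ∷ cs) inc (⊖ full) ⟧qf par (z ++ v) ⇔ val (lookup z i) ≤ - + Q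
      bottom-val i = below-val i (⊖ full) (cong -_ eval-full)
      mid-val : ∀ {J} (i : Fin J) z → ⟦ below i (c ∷ cs) inc (half ⊕ const -1ℤ) ⟧qf par (z ++ v) ⇔ val (lookup z i) ≤ + suc e + -1ℤ
      mid-val i = below-val i (half ⊕ const -1ℤ) (cong (λ t → t + -1ℤ) (trans (eval-powS E) (cong +_ P≡)))
      l : ∀ c r → 0ℤ - (c * -1ℤ + r) ≡ c - r
      l = solve-∀
      digit-≤ : d ≤ 0ℤ → linSum (eval cs u) v ≤ evalPoly c u
      digit-≤ h = shift-≤ h (l (evalPoly c u) (linSum (eval cs u) v))
      ≤-digit : linSum (eval cs u) v ≤ evalPoly c u → d ≤ 0ℤ
      ≤-digit h = shift-≤ h (sym (l (evalPoly c u) (linSum (eval cs u) v)))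

    split-Fin : ∀ {m n} {P : Fin (m ℕ.+ n) → Set} → (∀ i → P (i ↑ˡ n)) → (∀ j → P (m ↑ʳ j)) → ∀ a → P a
    split-Fin {zero} f g a = g a
    split-Fin {suc m} f g zero = f zero
    split-Fin {suc m} {P = P} f g (suc a) = split-Fin {P = P ∘ suc} (f ∘ suc) g a

    solve : (θ : QF k n) (inc : coeffs θ ⊆ ps) {v : Vec ℤ n} → v ⊑ X → ∃ (Solves θ inc v)
    solve (ineq cs c) inc v≤ = solve-ineq cs c inc v≤
    solve tt′ inc v≤ = [] , record { sound = λ _ _ _ → tt , mk⇔ id id ; complete = λ _ _ _ () }
    solve ff′ inc v≤ = [] , record { sound = λ _ _ _ → tt , mk⇔ id id ; complete = λ _ _ _ () }
    solve (θ ∧′ η) inc {v} v≤ with solve θ (inc ∘ ∈P.∈-++⁺ˡ) v≤ | solve η (inc ∘ ∈P.∈-++⁺ʳ (coeffs θ)) v≤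
    ... | x , X₁ | y , Y₁ = x ++ y , record
      { sound = λ ι z eqs →
          let a , e₁ = sound X₁ (ι ∘ (_↑ˡ size η)) z (λ i → trans (eqs (i ↑ˡ size η)) (VecP.lookup-++ˡ x y i))
              c , e₂ = sound Y₁ (ι ∘ (size θ ↑ʳ_)) z (λ i → trans (eqs (size θ ↑ʳ i)) (VecP.lookup-++ʳ x y i))
          in (a , c) , mk⇔ (λ (p , q) → to e₁ p , to e₂ q) (λ (p , q) → from e₁ p , from e₂ q)
      ; complete = λ ι z (a , c) → split-Fin
          (λ i → trans (complete X₁ (ι ∘ (_↑ˡ size η)) z a i) (sym (VecP.lookup-++ˡ x y i)))
          (λ i → trans (complete Y₁ (ι ∘ (size θ ↑ʳ_)) z c i) (sym (VecP.lookup-++ʳ x y i)))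
      }
    solve (θ ∨′ η) inc {v} v≤ with solve θ (inc ∘ ∈P.∈-++⁺ˡ) v≤ | solve η (inc ∘ ∈P.∈-++⁺ʳ (coeffs θ)) v≤
    ... | x , X₁ | y , Y₁ = x ++ y , record
      { sound = λ ι z eqs →
          let a , e₁ = sound X₁ (ι ∘ (_↑ˡ size η)) z (λ i → trans (eqs (i ↑ˡ size η)) (VecP.lookup-++ˡ x y i))
              c , e₂ = sound Y₁ (ι ∘ (size θ ↑ʳ_)) z (λ i → trans (eqs (size θ ↑ʳ i)) (VecP.lookup-++ʳ x y i))
          in (a , c) , mk⇔ (Sum.map (to e₁) (to e₂)) (Sum.map (from e₁) (from e₂))
      ; complete = λ ι z (a , c) → split-Fin
          (λ i → trans (complete X₁ (ι ∘ (_↑ˡ size η)) z a i) (sym (VecP.lookup-++ˡ x y i)))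
          (λ i → trans (complete Y₁ (ι ∘ (size θ ↑ʳ_)) z c i) (sym (VecP.lookup-++ʳ x y i)))
      }
    solve (¬′ θ) inc v≤ with solve θ inc v≤
    ... | x , X₁ = x , record
      { sound = λ ι z eqs → let a , e = sound X₁ ι z eqs in a , mk⇔ (λ ¬p p → ¬p (from e p)) (λ ¬p p → ¬p (to e p))
      ; complete = complete X₁
      }

    block-solve : ∀ q (θ : QF k n) (inc : coeffs θ ⊆ ps) {v : Vec ℤ n} → v ⊑ X →
      ⟦ block q (size θ) (qf (relative q (valid θ inc id) (encode θ inc id))) ⟧ par v ⇔ ⟦ θ ⟧qf u v
    block-solve q θ inc {v} v≤ with solve θ inc v≤
    block-solve ∃q θ inc {v} v≤ | x , X₁ = mk⇔
      (λ h → let z , a , p = to (block-correct ∃q (size θ) (qf (relative ∃q (valid θ inc id) (encode θ inc id)))) h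
             in to (proj₂ (sound X₁ id z (complete X₁ id z a))) p)
      (λ p → from (block-correct ∃q (size θ) (qf (relative ∃q (valid θ inc id) (encode θ inc id))))
        (let a , e = sound X₁ id x (λ _ → refl) in x , a , from e p))
    block-solve ∀q θ inc {v} v≤ | x , X₁ = mk⇔
      (λ h → let a , e = sound X₁ id x (λ _ → refl)
             in to e (to (relative-correct ∀q (valid θ inc id) (encode θ inc id))
                  (to (block-correct ∀q (size θ) (qf (relative ∀q (valid θ inc id) (encode θ inc id)))) h x) a))
      (λ p → from (block-correct ∀q (size θ) (qf (relative ∀q (valid θ inc id) (encode θ inc id))))
        (λ z → from (relative-correct ∀q (valid θ inc id) (encode θ inc id))
          (λ a → from (proj₂ (sound X₁ id z (complete X₁ id z a))) p)))

-- Bounded quantifiers and the translated formula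

abs≤ : Poly k → QF k (suc n)
abs≤ p = ineq (const 1ℤ ∷ replicate _ (const 0ℤ)) p ∧′ ineq (const -1ℤ ∷ replicate _ (const 0ℤ)) p

abs≤-correct : ∀ {p : Poly k} {u B} → evalPoly p u ≡ + B → ∀ y (v : Vec ℤ n) → ⟦ abs≤ p ⟧qf u (y ∷ v) ⇔ ∣ y ∣ ℕ.≤ B
abs≤-correct {p = p} {u} {B} e y v = mk⇔
  (λ (h , h′) → bound y (subst₂ _≤_ (up 1ℤ y (ℤP.*-identityˡ y)) e h) (subst₂ _≤_ (up -1ℤ (- y) (ℤP.-1*i≡-i y)) e h′))
  (λ h → subst₂ _≤_ (sym (up 1ℤ y (ℤP.*-identityˡ y))) (sym e) (ℤP.≤-trans (≤∣∣ y) (+≤+ h))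
       , subst₂ _≤_ (sym (up -1ℤ (- y) (ℤP.-1*i≡-i y))) (sym e) (ℤP.≤-trans (-≤∣∣ y) (+≤+ h)))
  where
  up : ∀ c x → c * y ≡ x → c * y + linSum (eval (replicate _ (const 0ℤ)) u) v ≡ x
  up c x e = trans (cong₂ _+_ e (linSum-zeros u v)) (ℤP.+-identityʳ x)
  bound : ∀ y → y ≤ + B → - y ≤ + B → ∣ y ∣ ℕ.≤ B
  bound (+ _) (+≤+ h) _ = h
  bound -[1+ _ ] _ (+≤+ h) = h

boxRadius : Poly 2 → ℕ → Poly 2
boxRadius g n = pow (var zero) n ⊗ g

eval-boxRadius : ∀ {s t g G} → evalPoly g (+ s ∷ t ∷ []) ≡ + G → ∀ n → evalPoly (boxRadius g n) (+ s ∷ t ∷ []) ≡ + (s ^ n ℕ.* G)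
eval-boxRadius {s} {t} {G = G} e n = trans (cong₂ _*_ (eval-pow {p = var zero} {u = + s ∷ t ∷ []} refl n) e) (sym (ℤP.pos-* (s ^ n) G))

box : Poly 2 → ∀ n → QF 2 n
box g zero = tt′
box g (suc n) = abs≤ (boxRadius g n) ∧′ weaken (box g n)

box-correct : ∀ {s t g G} → evalPoly g (+ s ∷ t ∷ []) ≡ + G → (v : Vec ℤ n) → ⟦ box g n ⟧qf (+ s ∷ t ∷ []) v ⇔ Box s G v
box-correct e [] = mk⇔ id id
box-correct {s = s} {t} {g} e (_∷_ {n} y v) = mk⇔
  (λ (a , b) → to head⇔ a , to (box-correct e v) (to (weaken-correct (box g n)) b))
  (λ (a , b) → from head⇔ a , from (weaken-correct (box g n)) (from (box-correct e v) b))
  where head⇔ = abs≤-correct {p = boxRadius g n} {u = + s ∷ t ∷ []} (eval-boxRadius {t = t} {g} e n) y v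

inner outer : Poly 2
inner = var zero
outer = var zero ⊗ var zero

eval-outer : ∀ {s t} → evalPoly outer (+ s ∷ t ∷ []) ≡ + (s ℕ.* s)
eval-outer {s} = sym (ℤP.pos-* s s)

depth : PForm k n → ℕ
depth (qf {n} θ) = n
depth (qnt _ φ) = depth φ

translate : ∀ {ps : List (Poly k)} → Quant → (φ : PForm k n) → coefficients φ ⊆ ps → PForm 2 n
translate {ps = ps} q (qf θ) inc = block q (size θ) (qf (relative q (Encode.valid ps θ inc id) (Encode.encode ps θ inc id)))
translate q (qnt {n} q′ φ) inc = qnt q′ (relative-P q′ (abs≤ (boxRadius outer n)) (translate q′ φ inc))

alts-replicate : ∀ q J → alts (List.replicate J q) ≡ 0
alts-replicate q zero = refl
alts-replicate q (suc zero) = refl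
alts-replicate ∀q (suc (suc J)) = alts-replicate ∀q (suc J)
alts-replicate ∃q (suc (suc J)) = alts-replicate ∃q (suc J)

-- The auxiliary block repeats the last quantifier.
alternations-translate : ∀ {ps : List (Poly k)} q (φ : PForm k n) (inc : coefficients φ ⊆ ps) →
  alternations (translate q φ inc) ≡ alternations φ
  × alts (q ∷ prefix (translate q φ inc)) ≡ alts (q ∷ prefix φ)
alternations-translate q (qf θ) inc =
  subst (λ qs → alts qs ≡ 0 × alts (q ∷ qs) ≡ 0) (sym (trans (prefix-block q (size θ) _) (ListP.++-identityʳ _)))
    (alts-replicate q (size θ) , alts-replicate q (suc (size θ)))
alternations-translate q (qnt {n} q′ φ) inc =
  subst (λ qs → alts (q′ ∷ qs) ≡ alts (q′ ∷ prefix φ) × alts (q ∷ q′ ∷ qs) ≡ alts (q ∷ q′ ∷ prefix φ))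
    (sym (prefix-relative q′ (abs≤ (boxRadius outer n)) (translate q′ φ inc)))
    (ih , extend q q′ ih)
  where
  ih = proj₂ (alternations-translate q′ φ inc)
  extend : ∀ q q′ {qs qs′} → alts (q′ ∷ qs) ≡ alts (q′ ∷ qs′) → alts (q ∷ q′ ∷ qs) ≡ alts (q ∷ q′ ∷ qs′)
  extend ∀q ∀q e = e
  extend ∀q ∃q e = cong suc e
  extend ∃q ∀q e = cong suc e
  extend ∃q ∃q e = e

module Translate (u : Vec ℤ k) (s T : ℕ) (1≤s : 1 ℕ.≤ s) (ps : List (Poly k))
  (small : ∀ {p} → p ∈ ps → ∣ evalPoly p u ∣ ℕ.≤ s) (smallT : ∀ {p} → p ∈ ps → ∣ evalPoly p u ∣ ℕ.≤ T) where

  -- Elimination runs from the matrix outwards, so goodness is assumed at the matrix, and `good`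
  -- reads off that of each outer level.
  MatrixGood : PForm k n → Set
  MatrixGood (qf θ) = Good s (systemOf (qf θ) u T)
  MatrixGood (qnt _ φ) = MatrixGood φ

  good : (φ : PForm k n) → MatrixGood φ → Good s (systemOf φ u T)
  good (qf θ) g = g
  good (qnt _ φ) g = proj₂ (good φ g)

  packedValue : PForm k n → ℤ
  packedValue φ = Digits.horner (λ p → evalPoly p u) (width (depth φ) s) s ps

  -- The matrix is decoded only for vectors in the outer box. A value of a quantified variable is
  -- exchanged by `Step.near` for a similar one in the box, against the same outer values, and
  -- `invariant` carries the truth of the formula along.
  translate-correct : ∀ q (φ : PForm k n) (inc : coefficients φ ⊆ ps) → MatrixGood φ → (v : Vec ℤ n) → Box s (s ℕ.* s) v →
    ⟦ translate q φ inc ⟧ (+ s ∷ packedValue φ ∷ []) v ⇔ ⟦ φ ⟧ u v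
  translate-correct q (qf θ) inc g v v∈ = Encode.Correct.block-solve ps u s 1≤s small q θ inc (box-⊑ 1≤s v v∈)
  translate-correct {n = n} q (qnt q′ φ) inc g v v∈ = cases q′
    where
    Γ : System (suc n)
    Γ = systemOf φ u T
    par : Vec ℤ 2
    par = + s ∷ packedValue φ ∷ []
    χ : QF 2 (suc n)
    χ = abs≤ (boxRadius outer n)
    χ⇔ : ∀ y → ⟦ χ ⟧qf par (y ∷ v) ⇔ ∣ y ∣ ℕ.≤ s ^ n ℕ.* (s ℕ.* s)
    χ⇔ y = abs≤-correct {p = boxRadius outer n} {u = par} (eval-boxRadius {t = packedValue φ} {outer} (eval-outer {s} {packedValue φ}) n) y v
    ih : ∀ q y → ∣ y ∣ ℕ.≤ s ^ n ℕ.* (s ℕ.* s) → ⟦ translate q φ inc ⟧ par (y ∷ v) ⇔ ⟦ φ ⟧ u (y ∷ v)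
    ih q y y≤ = translate-correct q φ inc g (y ∷ v) (y≤ , v∈)
    representative : ∀ y → ∃ λ y′ → Similar Γ (y ∷ v) (y′ ∷ v) × ∣ y′ ∣ ℕ.≤ s ^ n ℕ.* (s ℕ.* s)
    representative y = let y′ , sim , y′≤ = Step.near (proj₁ (good φ g)) (ℕP.*-mono-≤ (1≤^ n 1≤s) 1≤s) (box-⊑ 1≤s v v∈) (similar-refl (elim Γ) v) y
      in y′ , sim , ℕP.≤-trans y′≤ (ℕP.≤-reflexive (swap-mult s (s ^ n) s))
    rel⇔ : ∀ q y → ⟦ relative-P q χ (translate q φ inc) ⟧ par (y ∷ v) ⇔ Relative q (⟦ χ ⟧qf par (y ∷ v)) (⟦ translate q φ inc ⟧ par (y ∷ v))
    rel⇔ q y = relative-P-correct q χ (translate q φ inc)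
    cases : ∀ q′ → ⟦ qnt q′ (relative-P q′ χ (translate q′ φ inc)) ⟧ par v ⇔ ⟦ qnt q′ φ ⟧ u v
    cases ∃q = mk⇔
      (λ (y , h) → let a , x = to (rel⇔ ∃q y) h in y , to (ih ∃q y (to (χ⇔ y) a)) x)
      (λ (y , x) → let y′ , sim , y′≤ = representative y
        in y′ , from (rel⇔ ∃q y′) (from (χ⇔ y′) y′≤ , from (ih ∃q y′ y′≤) (invariant φ (smallT ∘ inc) sim x)))
    cases ∀q = mk⇔
      (λ h y → let y′ , sim , y′≤ = representative y
        in invariant φ (smallT ∘ inc) (similar-sym Γ sim) (to (ih ∀q y′ y′≤) (to (rel⇔ ∀q y′) (h y′) (from (χ⇔ y′) y′≤))))
      (λ x y → from (rel⇔ ∀q y) (λ a → from (ih ∀q y (to (χ⇔ y) a)) (x y)))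

-- Sizes of the initial system

size-forms : (θ : QF k n) (u : Vec ℤ k) → length (forms-qf θ u) ≡ size θ
size-forms (ineq cs c) u = refl
size-forms tt′ u = refl
size-forms ff′ u = refl
size-forms (θ ∧′ η) u = trans (ListP.length-++ (forms-qf θ u)) (cong₂ ℕ._+_ (size-forms θ u) (size-forms η u))
size-forms (θ ∨′ η) u = trans (ListP.length-++ (forms-qf θ u)) (cong₂ ℕ._+_ (size-forms θ u) (size-forms η u))
size-forms (¬′ θ) u = size-forms θ u

small-forms : ∀ {B} (θ : QF k n) {u : Vec ℤ k} → (∀ {p} → p ∈ coeffs θ → ∣ evalPoly p u ∣ ℕ.≤ B) →
  ∀ {h} → h ∈ forms-qf θ u → h ⊑ B
small-forms {k = k} {B = B} (ineq cs c) {u} small (here refl) = go cs (small ∘ there)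
  where
  go : ∀ {m} (cs : Vec (Poly k) m) → (∀ {p} → p ∈ toList cs → ∣ evalPoly p u ∣ ℕ.≤ B) → eval cs u ⊑ B
  go [] small = []
  go (p ∷ cs) small = small (here refl) ∷ go cs (small ∘ there)
small-forms (θ ∧′ η) {u} small h∈ with ∈P.∈-++⁻ (forms-qf θ u) h∈
... | inj₁ l = small-forms θ (small ∘ ∈P.∈-++⁺ˡ) l
... | inj₂ r = small-forms η (small ∘ ∈P.∈-++⁺ʳ (coeffs θ)) r
small-forms (θ ∨′ η) {u} small h∈ with ∈P.∈-++⁻ (forms-qf θ u) h∈
... | inj₁ l = small-forms θ (small ∘ ∈P.∈-++⁺ˡ) l
... | inj₂ r = small-forms η (small ∘ ∈P.∈-++⁺ʳ (coeffs θ)) r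
small-forms (¬′ θ) small h∈ = small-forms θ small h∈

-- Squares, because absolute values are not polynomial; the constant 2 supplies the bound `2 ≤ N` on
-- which `Sizes` rests.
normPoly : List (Poly k) → Poly k
normPoly [] = const (+ 2)
normPoly (p ∷ ps) = (p ⊗ p) ⊕ normPoly ps

norm : List (Poly k) → Vec ℤ k → ℕ
norm [] u = 2
norm (p ∷ ps) u = ∣ evalPoly p u ∣ ℕ.* ∣ evalPoly p u ∣ ℕ.+ norm ps u

square : ∀ x → x * x ≡ + (∣ x ∣ ℕ.* ∣ x ∣)
square (+ n) = sym (ℤP.pos-* n n)
square -[1+ n ] = refl

eval-norm : ∀ (ps : List (Poly k)) u → evalPoly (normPoly ps) u ≡ + norm ps u
eval-norm [] u = refl
eval-norm (p ∷ ps) u = cong₂ _+_ (square (evalPoly p u)) (eval-norm ps u)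

2≤norm : ∀ (ps : List (Poly k)) u → 2 ℕ.≤ norm ps u
2≤norm [] u = ℕP.≤-refl
2≤norm (p ∷ ps) u = ℕP.≤-trans (2≤norm ps u) (ℕP.m≤n+m _ _)

∈-norm : ∀ {ps : List (Poly k)} {u p} → p ∈ ps → ∣ evalPoly p u ∣ ℕ.≤ norm ps u
∈-norm {u = u} {p} (here {xs = ps} refl) = ℕP.≤-trans (≤-square ∣ evalPoly p u ∣) (ℕP.m≤m+n _ _)
  where
  ≤-square : ∀ a → a ℕ.≤ a ℕ.* a
  ≤-square zero = ℕ.z≤n
  ≤-square (suc a) = ℕP.m≤m*n (suc a) (suc a)
∈-norm (there p∈) = ℕP.≤-trans (∈-norm p∈) (ℕP.m≤n+m _ _)

exponent : PForm k n → ℕ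
exponent (qf {n} θ) = need n (size θ) 1
exponent (qnt _ φ) = exponent φ

-- Cardinalities

upper-bound : (f : A → ℕ) (xs : List A) → ∃ λ B → ∀ {x} → x ∈ xs → f x ℕ.≤ B
upper-bound f [] = 0 , λ ()
upper-bound f (x ∷ xs) = let B , h = upper-bound f xs in f x ℕ.+ B ,
  λ { (here refl) → ℕP.m≤m+n _ _ ; (there x∈) → ℕP.≤-trans (h x∈) (ℕP.m≤n+m _ _) }

∣_∣₁ : Vec ℤ n → ℕ
∣ [] ∣₁ = 0
∣ x ∷ v ∣₁ = ∣ x ∣ ℕ.+ ∣ v ∣₁

norm-box : ∀ {s g} → 1 ℕ.≤ s → (v : Vec ℤ n) → ∣ v ∣₁ ℕ.≤ g → Box s g v
norm-box 1≤s [] _ = tt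
norm-box {s = s} {g} 1≤s (_∷_ {n} y v) h =
  ℕP.≤-trans (ℕP.m≤m+n _ _) (ℕP.≤-trans h (ℕP.m≤n*m g (s ^ n) {{ℕ.>-nonZero (1≤^ n 1≤s)}})) ,
  norm-box 1≤s v (ℕP.≤-trans (ℕP.m≤n+m _ _) h)

module Counting {d : ℕ} {S : Vec ℤ d → Set} {F : Vec ℤ (suc d) → Set} {In Out : Vec ℤ d → Set}
  (in? : ∀ x → Dec (In x)) (In⇒Out : ∀ {x} → In x → Out x)
  (F⇔ : ∀ x w → F (x ∷ʳ w) ⇔ ((¬ In x ⊎ w ≡ 0ℤ) × Out x × S x))
  (witness : ∀ {x} → S x → ¬ In x → ∃ λ x′ → S x′ × ¬ In x′ × Out x′)
  (unbounded : ∀ {x} → S x → ¬ In x → ∀ B → ∃ λ x′ → S x′ × B ℕ.< ∣ x′ ∣₁) where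

  lift-zero : ∀ {x} → S x → In x → F (x ∷ʳ 0ℤ)
  lift-zero Sx Ix = from (F⇔ _ 0ℤ) (inj₂ refl , In⇒Out Ix , Sx)

  -- A point of `S` outside `In` would yield points of arbitrarily large norm, so a finite `S` lies
  -- within `In`, and over it the last coordinate is 0.
  card-lift : ∀ m → HasCard S m → HasCard F m
  card-lift m (xs , len , uniq , mem) = List.map (_∷ʳ 0ℤ) xs , trans (ListP.length-map (_∷ʳ 0ℤ) xs) len ,
    UniqueP.map⁺ (λ {x} {y} → VecP.∷ʳ-injectiveˡ x y) uniq , mem′
    where
    inside : ∀ {x} → S x → In x
    inside {x} Sx with in? x
    ... | yes Ix = Ix
    ... | no ¬Ix = let B , h = upper-bound ∣_∣₁ xs ; x′ , Sx′ , far = unbounded Sx ¬Ix B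
                   in ⊥-elim (ℕP.<⇒≱ far (h (to (mem x′) Sx′)))
    mem′ : ∀ v → F v ⇔ v ∈ List.map (_∷ʳ 0ℤ) xs
    mem′ v with initLast v
    ... | x , w , refl = mk⇔ fwd bwd
      where
      fwd : F (x ∷ʳ w) → x ∷ʳ w ∈ List.map (_∷ʳ 0ℤ) xs
      fwd Fv with to (F⇔ x w) Fv
      ... | inj₁ ¬Ix , _ , Sx = ⊥-elim (¬Ix (inside Sx))
      ... | inj₂ refl , _ , Sx = ∈P.∈-map⁺ (_∷ʳ 0ℤ) (to (mem x) Sx)
      bwd : x ∷ʳ w ∈ List.map (_∷ʳ 0ℤ) xs → F (x ∷ʳ w)
      bwd v∈ = let x′ , x′∈ , e = ∈P.∈-map⁻ (_∷ʳ 0ℤ) v∈ ; Sx′ = from (mem x′) x′∈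
               in subst F (sym e) (lift-zero Sx′ (inside Sx′))

  -- A point of `S` outside `In` yields one in the shell, over which every last coordinate is
  -- allowed, against the bound on the list. Hence `S` lies within `In` and is the image of `F`
  -- under `init`; removing duplicates from that image gives its enumeration.
  finite-drop : Finite F → Finite S
  finite-drop (m , ys , len , uniq , mem) = length zs , zs , refl , DecUniqueP.deduplicate-! _≟_ (List.map init ys) , mem′
    where
    _≟_ = VecP.≡-dec Data.Integer._≟_
    zs = deduplicate _≟_ (List.map init ys)
    inside : ∀ {x} → S x → In x
    inside {x} Sx with in? x
    ... | yes Ix = Ix
    ... | no ¬Ix =
      let x′ , Sx′ , ¬Ix′ , Ox′ = witness Sx ¬Ix
          B , h = upper-bound (∣_∣ ∘ last) ys
          w = + suc B
          y∈ = to (mem (x′ ∷ʳ w)) (from (F⇔ x′ w) (inj₁ ¬Ix′ , Ox′ , Sx′))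
      in ⊥-elim (ℕP.<⇒≱ (ℕP.n<1+n B) (subst (λ z → ∣ z ∣ ℕ.≤ B) (VecP.last-∷ʳ w x′) (h y∈)))
    mem′ : ∀ x → S x ⇔ x ∈ zs
    mem′ x = mk⇔
      (λ Sx → ∈P.∈-deduplicate⁺ _≟_ (subst (_∈ List.map init ys) (VecP.init-∷ʳ 0ℤ x)
                 (∈P.∈-map⁺ init (to (mem (x ∷ʳ 0ℤ)) (lift-zero Sx (inside Sx))))))
      (λ x∈ → let y , y∈ , e = ∈P.∈-map⁻ init (∈P.∈-deduplicate⁻ _≟_ (List.map init ys) x∈)
              in subst S (sym e) (back y (from (mem y) y∈)))
      where
      back : ∀ y → F y → S (init y)
      back y Fy with initLast y
      ... | x , w , refl = proj₂ (proj₂ (to (F⇔ x w) Fy))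

-- The two-parameter family and the reduction

last≡0 : QF k (suc n)
last≡0 = ineq (replicate _ (const 0ℤ) ∷ʳ const 1ℤ) (const 0ℤ) ∧′ ineq (replicate _ (const 0ℤ) ∷ʳ const -1ℤ) (const 0ℤ)

last≡0-correct : ∀ {u : Vec ℤ k} (v : Vec ℤ n) w → ⟦ last≡0 ⟧qf u (v ∷ʳ w) ⇔ w ≡ 0ℤ
last≡0-correct {u = u} v w = mk⇔
  (λ (a , b) → ℤP.≤-antisym (subst (_≤ 0ℤ) (val 1ℤ w (ℤP.*-identityˡ w)) a)
     (subst (0ℤ ≤_) (ℤP.neg-involutive w) (ℤP.neg-mono-≤ (subst (_≤ 0ℤ) (val -1ℤ (- w) (ℤP.-1*i≡-i w)) b))))
  (λ { refl → ℤP.≤-reflexive (val 1ℤ 0ℤ refl) , ℤP.≤-reflexive (val -1ℤ 0ℤ refl) })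
  where
  val : ∀ c x → c * w ≡ x → linSum (eval (replicate _ (const 0ℤ) ∷ʳ const c) u) (v ∷ʳ w) ≡ x
  val c x e = trans (linSum-eval-∷ʳ (replicate _ (const 0ℤ)) (const c) u v w)
    (trans (cong₂ _+_ (linSum-zeros u v) e) (ℤP.+-identityˡ x))

module Reduction {k d : ℕ} (φ : PForm k d) where

  ps : List (Poly k)
  ps = coefficients φ

  -- The successor in the exponent ensures that `s` is at least the norm, also when `exponent φ` is
  -- 0; so `s` bounds every packed coefficient.
  sPoly tPoly : Poly k
  sPoly = pow (normPoly ps) (suc (exponent φ))
  tPoly = hornerPoly (basePoly sPoly (depth φ)) ps

  -- `relative-P ∃q` conjoins the box of the free variables; the `∃q` given to `translate` binds the
  -- auxiliary block when `φ` is quantifier-free.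
  bounded : PForm 2 d
  bounded = relative-P ∃q (box outer d) (translate ∃q φ id)

  -- The family meets the shell between the two boxes iff it is infinite; leaving the last coordinate free there
  -- transfers the infinitude.
  target : PForm 2 (suc d)
  target = relative-P ∃q ((¬′ weakenʳ (box inner d)) ∨′ last≡0)
    (weakenʳ-P bounded)

  alternations-target : alternations target ≡ alternations φ
  alternations-target = trans
    (cong alts (trans (prefix-relative ∃q _ (weakenʳ-P bounded))
      (trans (prefix-weakenʳ bounded) (prefix-relative ∃q (box outer d) (translate ∃q φ id)))))
    (proj₁ (alternations-translate ∃q φ id))

  module At (u : Vec ℤ k) where

    N s : ℕ
    N = norm ps u
    s = N ^ suc (exponent φ)

    open Sizes N (2≤norm ps u)

    1≤s : 1 ℕ.≤ s
    1≤s = 1≤pow (suc (exponent φ))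

    N≤pow1 : N ℕ.≤ N ^ 1
    N≤pow1 = ℕP.≤-reflexive (sym (ℕP.*-identityʳ N))

    N≤s : N ℕ.≤ s
    N≤s = ℕP.≤-trans N≤pow1 (pow-≤ (ℕ.s≤s (ℕ.z≤n {exponent φ})))

    open Translate u s N 1≤s ps (λ p∈ → ℕP.≤-trans (∈-norm p∈) N≤s) ∈-norm

    matrix-good : ∀ {m} (η : PForm k m) → coefficients η ⊆ ps → N ^ exponent η ℕ.≤ s → MatrixGood η
    matrix-good (qf θ) inc h = sized-good {l = size θ} {e = 1} (record
      { few = ℕP.≤-reflexive (size-forms θ u)
      ; small = λ h∈ → ⊑-mono N≤pow1 (small-forms θ (∈-norm ∘ inc) h∈)
      ; thr≤ = N≤pow1
      ; mod≤ = 1≤pow 1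
      }) h
    matrix-good (qnt _ η) inc h = matrix-good η inc h

    mg : MatrixGood φ
    mg = matrix-good φ id (pow-≤ (ℕP.n≤1+n (exponent φ)))

    par : Vec ℤ 2
    par = + s ∷ packedValue φ ∷ []

    par-eval : evalPoly sPoly u ∷ evalPoly tPoly u ∷ [] ≡ par
    par-eval = cong₂ (λ a b → a ∷ b ∷ []) eval-s (eval-horner (basePoly sPoly (depth φ)) (eval-base {p = sPoly} (depth φ) eval-s) ps)
      where
      eval-s : evalPoly sPoly u ≡ + s
      eval-s = eval-pow {p = normPoly ps} (eval-norm ps u) (suc (exponent φ))

    S : Vec ℤ d → Set
    S = Family φ u

    target⇔ : ∀ x w → ⟦ target ⟧ par (x ∷ʳ w) ⇔ ((¬ Box s s x ⊎ w ≡ 0ℤ) × Box s (s ℕ.* s) x × S x)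
    target⇔ x w = mk⇔
      (λ h → let a , b = to r₁ h ; c , e = to r₂ (to (weakenʳ-P-correct bounded {par} {x} {w}) b) ; o = to out c
             in Sum.map (λ ¬i i → ¬i (from (weakenʳ-correct (box inner d)) (from in′ i))) (to (last≡0-correct x w)) a , o , to (translate-correct ∃q φ id mg x o) e)
      (λ (a , o , Sx) → from r₁ (Sum.map (λ ¬i i → ¬i (to in′ (to (weakenʳ-correct (box inner d)) i))) (from (last≡0-correct x w)) a
        , from (weakenʳ-P-correct bounded {par} {x} {w}) (from r₂ (from out o , from (translate-correct ∃q φ id mg x o) Sx))))
      where
      r₁ = relative-P-correct ∃q ((¬′ weakenʳ (box inner d)) ∨′ last≡0) (weakenʳ-P bounded) {par} {x ∷ʳ w}
      r₂ = relative-P-correct ∃q (box outer d) (translate ∃q φ id) {par} {x}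
      out = box-correct {g = outer} (eval-outer {s} {packedValue φ}) x
      in′ = box-correct {s = s} {t = packedValue φ} {g = inner} {G = s} refl x

    escape′ : ∀ {x g} → s ℕ.≤ g → S x → ¬ Box s s x → ∃ λ x′ → S x′ × ¬ Box s g x′ × Box s (s ℕ.* g) x′
    escape′ {x} s≤g Sx out = let x′ , sim , a , b = escape (systemOf φ u N) (good φ mg) s≤g x out
      in x′ , invariant φ ∈-norm sim Sx , a , b

    unbounded : ∀ {x} → S x → ¬ Box s s x → ∀ B → ∃ λ x′ → S x′ × B ℕ.< ∣ x′ ∣₁
    -- `s + B` is at least `s`, as `escape′` asks; a vector of norm at most `B` would lie in that
    -- box.
    unbounded Sx out B = let x′ , Sx′ , a , _ = escape′ {g = s ℕ.+ B} (ℕP.m≤m+n s B) Sx out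
      in x′ , Sx′ , ℕP.≰⇒> (λ h → a (norm-box 1≤s x′ (ℕP.≤-trans h (ℕP.m≤n+m B s))))

    -- `escape′` at `g = s` lands in the shell between the boxes of parameters `s` and `s * s`.
    open Counting {S = S} {F = ⟦ target ⟧ par} (box? s s) (λ {x} → box-mono x (ℕP.m≤m*n s s {{ℕ.>-nonZero 1≤s}}))
      target⇔ (escape′ ℕP.≤-refl) unbounded public

  reduces : CountingReducesVia φ target (sPoly ∷ tPoly ∷ [])
  reduces u = subst (λ w → (Infinite (Family φ u) → Infinite (Family target w)) × (∀ n → HasCard (Family φ u) n → HasCard (Family target w) n))
    (sym (At.par-eval u)) ((λ inf fin → inf (At.finite-drop u fin)) , At.card-lift u)

theorem3p2 : (k d : ℕ) (φ : PForm k d) →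
    Σ ℕ λ d′ → Σ (PForm 2 d′) λ ψ →
    alternations ψ ≡ alternations φ × CountingReduces φ ψ
theorem3p2 k d φ = suc d , target , alternations-target , sPoly ∷ tPoly ∷ [] , reduces
  where open Reduction φ
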